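{- Let $H_n$ be the pyrene system with $n$ pyrene fragments, and let $Af(H_0,x)=1$. Then $Af(H_1,x)=2x^3+2x^2+2x$ and for all $n\ge2$, $$Af(H_n,x)=(2x^3+2x^2+2x)Af(H_{n-1},x)-x^2Af(H_{n-2},x).$$
   Context: Pyrene system: draw the hexagonal lattice so that every hexagon has two vertical sides; horizontally adjacent hexagons then share a vertical edge. For $n\ge1$, $H_n$ is the hexagonal system (the plane graph formed by the vertices and edges of the following $4n$ hexagons) consisting of a horizontal linear row of $2n$ hexagons $h_{1,1},h_{1,2},\dots,h_{n,1},h_{n,2}$, consecutive ones sharing a vertical edge, together with, for each $i$, a hexagon $s_{i,1}$ directly above and a hexagon $s_{i,2}$ directly below the common edge of $h_{i,1}$ and $h_{i,2}$ (each sharing an edge with both $h_{i,1}$ and $h_{i,2}$). $H_0$ is the null graph. For a perfect matching $M$ of $G$, an anti-forcing set of $M$ is a set $S\subseteq E(G)\setminus M$ such that $M$ is the unique perfect matching of $G-S$; the anti-forcing number $af(G,M)$ is the minimum size of an anti-forcing set of $M$. The anti-forcing polynomial is $Af(G,x)=\sum_{M\in\mathcal{M}(G)}x^{af(G,M)}$, where $\mathcal{M}(G)$ is the set of perfect matchings of $G$. -}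

module Defs where

open import Data.Integer as ℤ using (ℤ; 0ℤ; 1ℤ)
open import Data.List using (List; []; _∷_; _++_; map; length; filter; foldr; concatMap; deduplicate; replicate; upTo)
open import Data.List.Extrema.Nat using (min)
open import Data.List.Membership.Propositional using (_∈_; _∉_)
open import Data.List.Membership.Propositional.Properties using (∈-concatMap⁺; ∈-concatMap⁻; ∈-deduplicate⁺; ∈-deduplicate⁻; ∈-filter⁻)
import Data.List.Membership.DecPropositional as DecMembership
import Data.List.Properties as List
open import Data.List.Relation.Unary.All as All using (All; []; _∷_; all?)
open import Data.List.Relation.Unary.Any as Any using (Any; here; there)
open import Data.List.Relation.Unary.Unique.Propositional using (Unique)
import Data.List.Relation.Unary.Unique.Propositional.Properties as Unique
import Data.List.Relation.Unary.Unique.DecPropositional.Properties as DecUnique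
open import Data.Nat using (ℕ; zero; suc; _+_; _*_; _<_)
import Data.Nat.Properties as ℕ
open import Data.Product using (_×_; _,_; proj₁; proj₂)
import Data.Product.Properties as Product
open import Data.Sum using (_⊎_)
open import Relation.Binary.Definitions using (DecidableEquality)
open import Relation.Binary.PropositionalEquality using (_≡_; refl)
open import Relation.Nullary using (¬?)
open import Relation.Nullary.Decidable using (_⊎-dec_)
open import Relation.Unary using (Decidable)

-- Polynomials in ℤ[x] as coefficient lists, constant term first.  Trailing
-- zeros are allowed, so equality of polynomials is _≈_ rather than _≡_.

Poly : Set
Poly = List ℤ

coeff : Poly → ℕ → ℤ
coeff []      _       = 0ℤ
coeff (a ∷ p) zero    = a
coeff (a ∷ p) (suc k) = coeff p k

infix 4 _≈_
_≈_ : Poly → Poly → Set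
p ≈ q = ∀ k → coeff p k ≡ coeff q k

0ₚ 1ₚ : Poly
0ₚ = []
1ₚ = 1ℤ ∷ []

X^_ : ℕ → Poly
X^ k = replicate k 0ℤ ++ 1ₚ

_·_ : ℤ → Poly → Poly
c · p = map (c ℤ.*_) p

_+ₚ_ : Poly → Poly → Poly
[]      +ₚ q       = q
(a ∷ p) +ₚ []      = a ∷ p
(a ∷ p) +ₚ (b ∷ q) = (a ℤ.+ b) ∷ (p +ₚ q)

_-ₚ_ : Poly → Poly → Poly
p -ₚ q = p +ₚ map ℤ.-_ q

_*ₚ_ : Poly → Poly → Poly
[]      *ₚ q = []
(a ∷ p) *ₚ q = (a · q) +ₚ (0ℤ ∷ (p *ₚ q))

infix  9 X^_
infixr 8 _·_
infixl 7 _*ₚ_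
infixl 6 _+ₚ_ _-ₚ_

∑ₚ : List Poly → Poly
∑ₚ = foldr _+ₚ_ 0ₚ

-- All sublists.  For a duplicate-free list these are its subsets, each listed
-- exactly once and in the order of the given list; hence two subsets of the
-- same list are equal as sets exactly when they are equal as lists.
subsets : ∀ {A : Set} → List A → List (List A)
subsets []       = [] ∷ []
subsets (x ∷ xs) = map (x ∷_) (subsets xs) ++ subsets xs

-- Finite simple graphs with vertices in A.  The undirected edge {u , v} is
-- listed once, as one of the pairs (u , v) and (v , u).
record Graph (A : Set) : Set where
  field
    V      : List A
    E      : List (A × A)
    V!     : Unique V
    E!     : Unique E
    ends   : ∀ {u v} → (u , v) ∈ E → u ∈ V × v ∈ V
    asym   : ∀ {u v} → (u , v) ∈ E → (v , u) ∉ E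

module AntiForcing {A : Set} (_≟_ : DecidableEquality A) where

  open Graph

  Edge : Set
  Edge = A × A

  _≟ᴱ_ : DecidableEquality Edge
  _≟ᴱ_ = Product.≡-dec _≟_ _≟_

  open DecMembership _≟ᴱ_ using (_∈?_)

  infixl 6 _∖_ _-_

  _∖_ : List Edge → List Edge → List Edge
  F ∖ S = filter (λ e → ¬? (e ∈? S)) F

  _-_ : Graph A → List Edge → Graph A
  G - S = record
    { V    = V G
    ; E    = E G ∖ S
    ; V!   = V! G
    ; E!   = Unique.filter⁺ notIn? (E! G)
    ; ends = λ e∈ → ends G (proj₁ (∈-filter⁻ notIn? e∈))
    ; asym = λ e∈ e′∈ → asym G (proj₁ (∈-filter⁻ notIn? e∈)) (proj₁ (∈-filter⁻ notIn? e′∈))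
    }
    where
    notIn? : Decidable (_∉ S)
    notIn? e = ¬? (e ∈? S)

  Incident : A → Edge → Set
  Incident v (a , b) = v ≡ a ⊎ v ≡ b

  incident? : ∀ v → Decidable (Incident v)
  incident? v (a , b) = (v ≟ a) ⊎-dec (v ≟ b)

  -- For M ⊆ E G: every vertex of G lies on exactly one edge of M.
  Perfect : Graph A → List Edge → Set
  Perfect G M = All (λ v → length (filter (incident? v) M) ≡ 1) (V G)

  perfect? : ∀ G → Decidable (Perfect G)
  perfect? G M = all? (λ v → length (filter (incident? v) M) ℕ.≟ 1) (V G)

  perfectMatchings : Graph A → List (List Edge)
  perfectMatchings G = filter (perfect? G) (subsets (E G))

  -- Deleting edges keeps the order of the edge list, so list equality is
  -- the correct comparison of M with the perfect matchings of G - S.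
  IsUniquePerfectMatching : Graph A → List Edge → Set
  IsUniquePerfectMatching G M = perfectMatchings G ≡ M ∷ []

  isUniquePerfectMatching? : ∀ G → Decidable (IsUniquePerfectMatching G)
  isUniquePerfectMatching? G M =
    List.≡-dec (List.≡-dec _≟ᴱ_) (perfectMatchings G) (M ∷ [])

  antiForcingSets : Graph A → List Edge → List (List Edge)
  antiForcingSets G M =
    filter (λ S → isUniquePerfectMatching? (G - S) M) (subsets (E G ∖ M))

  -- The first argument of min only provides the value for an empty list; for a
  -- perfect matching M the list is nonempty, since E G ∖ M is anti-forcing, and
  -- all its entries are at most |E G|.
  af : Graph A → List Edge → ℕ
  af G M = min (length (E G)) (map length (antiForcingSets G M))

  Af : Graph A → Poly
  Af G = ∑ₚ (map (λ M → X^ (af G M)) (perfectMatchings G))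

-- The hexagonal lattice with two vertical sides per hexagon, horizontal unit
-- √3/2 and vertical unit 1/2 times the side length.  A hexagon is named by the
-- lower left corner (a , b) of its bounding box, which has size 2 × 4.  The
-- hexagon to its right is (a + 2 , b); the one above their common vertical
-- side is (a + 1 , b + 3), and the one below it is (a + 1 , b - 3).

Point : Set
Point = ℕ × ℕ

_≟ᴾ_ : DecidableEquality Point
_≟ᴾ_ = Product.≡-dec ℕ._≟_ ℕ._≟_

open AntiForcing _≟ᴾ_ public

Hexagon : Set
Hexagon = ℕ × ℕ

bottom lowerRight upperRight top upperLeft lowerLeft : Hexagon → Point
bottom     (a , b) = 1 + a , b
lowerRight (a , b) = 2 + a , 1 + b
upperRight (a , b) = 2 + a , 3 + b
top        (a , b) = 1 + a , 4 + b
upperLeft  (a , b) = a     , 3 + b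
lowerLeft  (a , b) = a     , 1 + b

corners : Hexagon → List Point
corners h = bottom h ∷ lowerRight h ∷ upperRight h ∷ top h ∷ upperLeft h ∷ lowerLeft h ∷ []

-- No lattice edge is horizontal; each is written with its lower end first, so
-- that a side shared by two hexagons is the same pair for both.
sides : Hexagon → List (Point × Point)
sides h = (bottom h , lowerRight h) ∷ (lowerRight h , upperRight h) ∷ (upperRight h , top h)
        ∷ (bottom h , lowerLeft h)  ∷ (lowerLeft h , upperLeft h)   ∷ (upperLeft h , top h) ∷ []

sides-ends : ∀ h → All (λ e → proj₁ e ∈ corners h × proj₂ e ∈ corners h) (sides h)
sides-ends h = (c₀ , c₁) ∷ (c₁ , c₂) ∷ (c₂ , c₃) ∷ (c₀ , c₅) ∷ (c₅ , c₄) ∷ (c₄ , c₃) ∷ []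
  where
  c₀ : bottom h ∈ corners h
  c₀ = here refl
  c₁ : lowerRight h ∈ corners h
  c₁ = there (here refl)
  c₂ : upperRight h ∈ corners h
  c₂ = there (there (here refl))
  c₃ : top h ∈ corners h
  c₃ = there (there (there (here refl)))
  c₄ : upperLeft h ∈ corners h
  c₄ = there (there (there (there (here refl))))
  c₅ : lowerLeft h ∈ corners h
  c₅ = there (there (there (there (there (here refl)))))

sides-upward : ∀ h → All (λ e → proj₂ (proj₁ e) < proj₂ (proj₂ e)) (sides h)
sides-upward (a , b) = one ∷ two ∷ one ∷ one ∷ two ∷ one ∷ []
  where
  one : ∀ {m} → m < 1 + m
  one = ℕ.≤-refl
  two : ∀ {m} → m < 2 + m
  two = ℕ.m≤n⇒m≤1+n ℕ.≤-refl

hexagonalSystem : List Hexagon → Graph Point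
hexagonalSystem hs = record
  { V    = deduplicate _≟ᴾ_ (concatMap corners hs)
  ; E    = deduplicate _≟ᴱ_ (concatMap sides hs)
  ; V!   = DecUnique.deduplicate-! _≟ᴾ_ _
  ; E!   = DecUnique.deduplicate-! _≟ᴱ_ _
  ; ends = λ e∈ → let h∈ = ∈-side e∈ in
      ∈-corner (Any.map (λ {h} s∈ → proj₁ (All.lookup (sides-ends h) s∈)) h∈) ,
      ∈-corner (Any.map (λ {h} s∈ → proj₂ (All.lookup (sides-ends h) s∈)) h∈)
  ; asym = λ e∈ e′∈ → ℕ.<-asym (upward e∈) (upward e′∈)
  }
  where
  ∈-side : ∀ {e} → e ∈ deduplicate _≟ᴱ_ (concatMap sides hs) → Any (λ h → e ∈ sides h) hs
  ∈-side e∈ = ∈-concatMap⁻ sides (∈-deduplicate⁻ _≟ᴱ_ (concatMap sides hs) e∈)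

  ∈-corner : ∀ {v} → Any (λ h → v ∈ corners h) hs → v ∈ deduplicate _≟ᴾ_ (concatMap corners hs)
  ∈-corner v∈ = ∈-deduplicate⁺ _≟ᴾ_ (∈-concatMap⁺ corners v∈)

  upward : ∀ {u v} → (u , v) ∈ deduplicate _≟ᴱ_ (concatMap sides hs) → proj₂ u < proj₂ v
  upward e∈ with Any.satisfied (∈-side e∈)
  ... | h , s∈ = All.lookup (sides-upward h) s∈

-- h₁ , h₂ , s₁ , s₂ of the i-th fragment, with i counted from 0.
pyreneFragment : ℕ → List Hexagon
pyreneFragment i =
    (4 * i     , 3)
  ∷ (4 * i + 2 , 3)
  ∷ (4 * i + 1 , 6)
  ∷ (4 * i + 1 , 0)
  ∷ []

H : ℕ → Graph Point
H n = hexagonalSystem (concatMap pyreneFragment (upTo n))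

{-# OPTIONS --safe #-}
module Submission where

-- A perfect matching of H n restricts to each fragment in one of six ways: both
-- hexagons s₁ and s₂ are matched among themselves (four letters hex x y), or the
-- ends of the left (letter L) or of the right (letter R) vertical side are matched
-- into the fragment.  The perfect matchings are thus the words of length n with no
-- factor R L.  The anti-forcing number is additive over letters, with weight 3 for
-- hex α α and hex β β, 2 for hex α β and hex β α, and 1 for L and R.  From below, a
-- word of weight k has k alternating cycles no two of which share an unmatched
-- edge; from above, a set of k edges forcing the word is read off letter by letter.
-- Summing x^weight over words without factor R L gives the recurrence.

open import Defs
open import Data.Bool using (Bool; true; false; not; _∧_; _∨_; T; T?)
open import Data.Bool.Properties using (∧-zeroʳ; ¬-not)
open import Data.Fin using (#_)
open import Data.Integer as ℤ using (ℤ; 0ℤ; +_)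
import Data.Integer.Properties as ℤ
open import Data.Integer.Solver using (module +-*-Solver)
open import Data.List using (List; []; _∷_; _++_; map; length; filter; foldr; concatMap; applyUpTo; upTo)
open import Data.List.Extrema.Nat using (min≤v⁺; v≤min⁺)
open import Data.List.Membership.Propositional using (_∈_; _∉_; lose; find)
open import Data.List.Membership.Propositional.Properties
open import Data.List.Membership.Propositional.Properties.WithK using (unique∧set⇒bag)
import Data.List.Membership.DecPropositional as DecMembership
open import Data.List.Properties using (length-++; length-map; ∷-injectiveʳ; filter-≐; map-∘; map-++; map-cong-local)
open import Data.List.Relation.Binary.BagAndSetEquality using (∼bag⇒↭)
open import Data.List.Relation.Binary.Permutation.Propositional as ↭ using (_↭_)
import Data.List.Relation.Binary.Permutation.Propositional.Properties as ↭
open import Data.List.Relation.Unary.All as All using (All; []; _∷_)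
open import Data.List.Relation.Unary.Any as Any using (here; there)
open import Data.List.Relation.Unary.Unique.Propositional using (Unique; []; _∷_)
import Data.List.Relation.Unary.Unique.Propositional.Properties as Unique
open import Data.Nat using (ℕ; zero; suc; _+_; _*_; _∸_; _⊓_; _≤_; _<_; _≥_; z≤n; s≤s; _≟_; _<?_)
import Data.Nat.Properties as ℕ
open import Data.Product using (_×_; _,_; proj₁; proj₂; ∃; map₁)
open import Data.Product.Properties using (,-injectiveʳ)
open import Data.Sum using (_⊎_; inj₁; inj₂)
open import Function using (_∘_; mk⇔)
open import Level using (0ℓ)
open import Relation.Binary.PropositionalEquality
open import Relation.Nullary using (¬_; ¬?; Dec; yes; no; contradiction; does)
open import Relation.Nullary.Decidable using (dec-true; dec-false)
open import Relation.Unary using (Pred; Decidable)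

open Graph
open DecMembership _≟ᴱ_ using (_∈?_)

private
  variable
    A : Set

unique-set⇒↭ : ∀ {xs ys : List A} → Unique xs → Unique ys →
               (∀ {x} → x ∈ xs → x ∈ ys) → (∀ {x} → x ∈ ys → x ∈ xs) → xs ↭ ys
unique-set⇒↭ xs! ys! f g = ∼bag⇒↭ (unique∧set⇒bag xs! ys! (mk⇔ f g))

unique-⊆⇒length≤ : ∀ {xs ys : List A} → Unique xs → (∀ {x} → x ∈ xs → x ∈ ys) → length xs ≤ length ys
unique-⊆⇒length≤ {xs = []} _ _ = z≤n
unique-⊆⇒length≤ {xs = x ∷ xs} (x∉ ∷ xs!) sub with ∈-∃++ (sub (here refl))
... | us , vs , refl = begin
  suc (length xs)              ≤⟨ s≤s (unique-⊆⇒length≤ xs! sub′) ⟩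
  suc (length (us ++ vs))      ≡⟨ cong suc (length-++ us) ⟩
  suc (length us + length vs)  ≡⟨ ℕ.+-suc (length us) (length vs) ⟨
  length us + suc (length vs)  ≡⟨ length-++ us ⟨
  length (us ++ x ∷ vs)        ∎
  where
  open ℕ.≤-Reasoning
  sub′ : ∀ {y} → y ∈ xs → y ∈ us ++ vs
  sub′ y∈ with ∈-++⁻ us (sub (there y∈))
  ... | inj₁ y∈us           = ∈-++⁺ˡ y∈us
  ... | inj₂ (here refl)    = contradiction refl (All.lookup x∉ y∈)
  ... | inj₂ (there y∈vs)   = ∈-++⁺ʳ us y∈vs

all-equal⇒singleton : ∀ {x : A} {xs} → Unique xs → x ∈ xs → (∀ {y} → y ∈ xs → y ≡ x) → xs ≡ x ∷ []
all-equal⇒singleton {xs = y ∷ []} _ _ eq = cong (_∷ []) (eq (here refl))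
all-equal⇒singleton {xs = y ∷ z ∷ xs} ((y≢z ∷ _) ∷ _) _ eq =
  contradiction (trans (eq (here refl)) (sym (eq (there (here refl))))) y≢z

∈-subsets⇒⊆ : ∀ (xs : List A) {ys} → ys ∈ subsets xs → ∀ {y} → y ∈ ys → y ∈ xs
∈-subsets⇒⊆ [] (here refl) ()
∈-subsets⇒⊆ (x ∷ xs) ys∈ y∈ with ∈-++⁻ (map (x ∷_) (subsets xs)) ys∈
... | inj₂ ys∈′ = there (∈-subsets⇒⊆ xs ys∈′ y∈)
... | inj₁ ys∈′ with ∈-map⁻ (x ∷_) ys∈′
...   | zs , zs∈ , refl with y∈
...     | here refl = here refl
...     | there y∈zs = there (∈-subsets⇒⊆ xs zs∈ y∈zs)

filter∈subsets : ∀ {P : Pred A 0ℓ} (P? : Decidable P) xs → filter P? xs ∈ subsets xs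
filter∈subsets P? [] = here refl
filter∈subsets P? (x ∷ xs) with P? x
... | yes _ = ∈-++⁺ˡ (∈-map⁺ (x ∷_) (filter∈subsets P? xs))
... | no  _ = ∈-++⁺ʳ (map (x ∷_) (subsets xs)) (filter∈subsets P? xs)

subsets-ext : ∀ {xs : List A} {ys zs} → Unique xs → ys ∈ subsets xs → zs ∈ subsets xs →
              (∀ {x} → x ∈ ys → x ∈ zs) → (∀ {x} → x ∈ zs → x ∈ ys) → ys ≡ zs
subsets-ext {xs = []} _ (here refl) (here refl) _ _ = refl
subsets-ext {xs = x ∷ xs} u@(_ ∷ xs!) ys∈ zs∈ f g
  with ∈-++⁻ (map (x ∷_) (subsets xs)) ys∈ | ∈-++⁻ (map (x ∷_) (subsets xs)) zs∈
... | inj₂ ys∈′ | inj₂ zs∈′ = subsets-ext xs! ys∈′ zs∈′ f g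
... | inj₁ ys∈′ | inj₂ zs∈′ with _ , _ , refl ← ∈-map⁻ (x ∷_) ys∈′ =
  contradiction (∈-subsets⇒⊆ xs zs∈′ (f (here refl))) (Unique.Unique[x∷xs]⇒x∉xs u)
... | inj₂ ys∈′ | inj₁ zs∈′ with _ , _ , refl ← ∈-map⁻ (x ∷_) zs∈′ =
  contradiction (∈-subsets⇒⊆ xs ys∈′ (g (here refl))) (Unique.Unique[x∷xs]⇒x∉xs u)
... | inj₁ ys∈′ | inj₁ zs∈′ with ∈-map⁻ (x ∷_) ys∈′ | ∈-map⁻ (x ∷_) zs∈′
...   | ys , ys∈″ , refl | zs , zs∈″ , refl = cong (x ∷_) (subsets-ext xs! ys∈″ zs∈″ (drop f ys∈″) (drop g zs∈″))
  where
  drop : ∀ {us vs} → (∀ {y} → y ∈ x ∷ us → y ∈ x ∷ vs) → us ∈ subsets xs → ∀ {y} → y ∈ us → y ∈ vs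
  drop h us∈ y∈ with h (there y∈)
  ... | there y∈vs = y∈vs
  ... | here refl = contradiction (∈-subsets⇒⊆ xs us∈ y∈) (Unique.Unique[x∷xs]⇒x∉xs u)

subset-unique : ∀ {xs : List A} {ys} → Unique xs → ys ∈ subsets xs → Unique ys
subset-unique {xs = []} _ (here refl) = []
subset-unique {xs = x ∷ xs} u@(x∉ ∷ xs!) ys∈ with ∈-++⁻ (map (x ∷_) (subsets xs)) ys∈
... | inj₂ ys∈′ = subset-unique xs! ys∈′
... | inj₁ ys∈′ with ∈-map⁻ (x ∷_) ys∈′
...   | zs , zs∈ , refl = All.tabulate (λ z∈ → All.lookup x∉ (∈-subsets⇒⊆ xs zs∈ z∈)) ∷ subset-unique xs! zs∈

subsets-unique : ∀ {xs : List A} → Unique xs → Unique (subsets xs)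
subsets-unique [] = [] ∷ []
subsets-unique {xs = x ∷ xs} u@(_ ∷ xs!) =
  Unique.++⁺ (Unique.map⁺ ∷-injectiveʳ (subsets-unique xs!)) (subsets-unique xs!) disjoint
  where
  disjoint : ∀ {ys} → ¬ (ys ∈ map (x ∷_) (subsets xs) × ys ∈ subsets xs)
  disjoint (p , q) with _ , _ , refl ← ∈-map⁻ (x ∷_) p =
    Unique.Unique[x∷xs]⇒x∉xs u (∈-subsets⇒⊆ xs q (here refl))

∈-subsets-filter : ∀ {P : Pred A 0ℓ} (P? : Decidable P) xs {ys} → ys ∈ subsets (filter P? xs) → ys ∈ subsets xs
∈-subsets-filter P? [] ys∈ = ys∈
∈-subsets-filter P? (x ∷ xs) ys∈ with P? x
... | no _ = ∈-++⁺ʳ (map (x ∷_) (subsets xs)) (∈-subsets-filter P? xs ys∈)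
... | yes _ with ∈-++⁻ (map (x ∷_) (subsets (filter P? xs))) ys∈
...   | inj₂ ys∈′ = ∈-++⁺ʳ (map (x ∷_) (subsets xs)) (∈-subsets-filter P? xs ys∈′)
...   | inj₁ ys∈′ with ∈-map⁻ (x ∷_) ys∈′
...     | zs , zs∈ , refl = ∈-++⁺ˡ (∈-map⁺ (x ∷_) (∈-subsets-filter P? xs zs∈))

perfectMatchings-unique : ∀ G → Unique (perfectMatchings G)
perfectMatchings-unique G = Unique.filter⁺ (perfect? G) (subsets-unique (E! G))

perfectMatching⊆E : ∀ G {M} → M ∈ perfectMatchings G → ∀ {e} → e ∈ M → e ∈ E G
perfectMatching⊆E G M∈ = ∈-subsets⇒⊆ (E G) (proj₁ (∈-filter⁻ (perfect? G) M∈))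

module _ {G : Graph Point} {S M : List Edge} where

  private
    notIn? : Decidable (_∉ S)
    notIn? e = ¬? (e ∈? S)

  ∈-deleted⁺ : M ∈ perfectMatchings G → (∀ {e} → e ∈ M → e ∉ S) → M ∈ perfectMatchings (G - S)
  ∈-deleted⁺ M∈ disj with ∈-filter⁻ (perfect? G) M∈
  ... | M∈sub , perf = ∈-filter⁺ (perfect? (G - S)) (subst (_∈ subsets (E G ∖ S)) (sym M≡) M′∈) perf
    where
    M′∈ : filter (_∈? M) (E G ∖ S) ∈ subsets (E G ∖ S)
    M′∈ = filter∈subsets (_∈? M) (E G ∖ S)
    M≡ : M ≡ filter (_∈? M) (E G ∖ S)
    M≡ = subsets-ext (E! G) M∈sub (∈-subsets-filter notIn? (E G) M′∈)
      (λ e∈ → ∈-filter⁺ (_∈? M) (∈-filter⁺ notIn? (∈-subsets⇒⊆ (E G) M∈sub e∈) (disj e∈)) e∈)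
      (λ e∈ → proj₂ (∈-filter⁻ (_∈? M) {xs = E G ∖ S} e∈))

  ∈-deleted⁻ : M ∈ perfectMatchings (G - S) → M ∈ perfectMatchings G × (∀ {e} → e ∈ M → e ∉ S)
  ∈-deleted⁻ M∈ with ∈-filter⁻ (perfect? (G - S)) M∈
  ... | M∈sub , perf =
    ∈-filter⁺ (perfect? G) (∈-subsets-filter notIn? (E G) M∈sub) perf ,
    λ e∈ → proj₂ (∈-filter⁻ notIn? {xs = E G} (∈-subsets⇒⊆ (E G ∖ S) M∈sub e∈))

antiForcing-hits : ∀ {G S M N} → S ∈ antiForcingSets G M → N ∈ perfectMatchings G → N ≢ M →
                   ∃ λ e → e ∈ S × e ∈ N × e ∉ M
antiForcing-hits {G} {S} {M} {N} S∈ N∈ N≢M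
  with ∈-filter⁻ (λ S → isUniquePerfectMatching? (G - S) M) {xs = subsets (E G ∖ M)} S∈ | Any.any? (_∈? N) S
... | S∈sub , _ | yes p = let e , e∈S , e∈N = find p in
  e , e∈S , e∈N , proj₂ (∈-filter⁻ (λ e → ¬? (e ∈? M)) {xs = E G} (∈-subsets⇒⊆ (E G ∖ M) S∈sub e∈S))
... | _ , uniq | no ¬p with subst (N ∈_) uniq (∈-deleted⁺ {G} {S} N∈ (λ e∈N e∈S → ¬p (lose e∈S e∈N)))
...   | here N≡M = contradiction N≡M N≢M

antiForcing-from : ∀ {G M} F → M ∈ perfectMatchings G → (∀ {e} → e ∈ M → e ∉ F) →
                   (∀ {N} → N ∈ perfectMatchings G → (∀ {e} → e ∈ N → e ∉ F) → N ≡ M) →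
                   ∃ λ S → S ∈ antiForcingSets G M × length S ≤ length F
antiForcing-from {G} {M} F M∈ disj uniq =
  S , ∈-filter⁺ (λ S → isUniquePerfectMatching? (G - S) M) (filter∈subsets (_∈? F) (E G ∖ M)) only ,
  unique-⊆⇒length≤ (Unique.filter⁺ (_∈? F) (Unique.filter⁺ notInM? (E! G))) ⊆F
  where
  notInM? : Decidable (_∉ M)
  notInM? e = ¬? (e ∈? M)
  S = filter (_∈? F) (E G ∖ M)
  ⊆F : ∀ {e} → e ∈ S → e ∈ F
  ⊆F e∈ = proj₂ (∈-filter⁻ (_∈? F) {xs = E G ∖ M} e∈)
  avoids : ∀ {N} → N ∈ perfectMatchings (G - S) → ∀ {e} → e ∈ N → e ∉ F
  avoids N∈ {e} e∈N e∈F with ∈-deleted⁻ {G} {S} N∈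
  ... | N∈G , N∩S with e ∈? M
  ...   | yes e∈M = disj e∈M e∈F
  ...   | no  e∉M = N∩S e∈N (∈-filter⁺ (_∈? F) (∈-filter⁺ notInM? (perfectMatching⊆E G N∈G e∈N) e∉M) e∈F)
  only : perfectMatchings (G - S) ≡ M ∷ []
  only = all-equal⇒singleton (perfectMatchings-unique (G - S))
    (∈-deleted⁺ {G} {S} M∈ (λ e∈M e∈S → disj e∈M (⊆F e∈S)))
    (λ N∈ → uniq (proj₁ (∈-deleted⁻ {G} {S} N∈)) (avoids N∈))

af-≡ : ∀ {G M k} → (∀ {S} → S ∈ antiForcingSets G M → k ≤ length S) →
       (∃ λ S → S ∈ antiForcingSets G M × length S ≤ k) → af G M ≡ k
af-≡ {G} {M} {k} lower (S , S∈ , S≤k) = ℕ.≤-antisym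
  (min≤v⁺ (length (E G)) _ (inj₂ (lose (∈-map⁺ length S∈) S≤k)))
  (v≤min⁺ (ℕ.≤-trans (lower S∈) S≤E) (All.tabulate bound))
  where
  S∈sub : S ∈ subsets (E G ∖ M)
  S∈sub = proj₁ (∈-filter⁻ (λ S → isUniquePerfectMatching? (G - S) M) {xs = subsets (E G ∖ M)} S∈)
  S≤E : length S ≤ length (E G)
  S≤E = unique-⊆⇒length≤ {ys = E G} (subset-unique (Unique.filter⁺ (λ e → ¬? (e ∈? M)) (E! G)) S∈sub)
    (λ e∈ → proj₁ (∈-filter⁻ (λ e → ¬? (e ∈? M)) {xs = E G} (∈-subsets⇒⊆ (E G ∖ M) S∈sub e∈)))
  bound : ∀ {m} → m ∈ map length (antiForcingSets G M) → k ≤ m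
  bound m∈ with ∈-map⁻ length m∈
  ... | S′ , S′∈ , refl = lower S′∈

-- Coordinates in the pyrene system

data Side : Set where
  up dn : Side

data Pos : Set where
  k0 k1 k2 k3 k4 k5 : Pos

-- The i-th fragment owns the two ends (pole) of its left vertical side and the
-- twelve corners of s₁ (up) and s₂ (dn), numbered around each hexagon from the
-- corner that lies on the common side of h₁ and h₂.
data VName : Set where
  pole : Side → VName
  ring : Side → Pos → VName

-- vert is the left vertical side of the fragment, link the common side of h₁
-- and h₂, ring s kⱼ the side of s from corner kⱼ to corner kⱼ₊₁, and pullˡ s and
-- pullʳ s join the hexagon s to the left and to the right vertical side.
data EName : Set where
  vert link   : EName
  ring        : Side → Pos → EName
  pullˡ pullʳ : Side → EName

VRef ERef : Set
VRef = ℕ × VName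
ERef = ℕ × EName

quad : ℕ → ℕ
quad zero    = 0
quad (suc i) = 4 + quad i

quad≡4* : ∀ i → quad i ≡ 4 * i
quad≡4* zero    = refl
quad≡4* (suc i) = trans (cong (λ x → 4 + x) (quad≡4* i)) (sym (ℕ.*-suc 4 i))

xOffset : VName → ℕ
xOffset (pole _)    = 0
xOffset (ring _ k0) = 2
xOffset (ring _ k1) = 1
xOffset (ring _ k2) = 1
xOffset (ring _ k3) = 2
xOffset (ring _ k4) = 3
xOffset (ring _ k5) = 3

height : VName → ℕ
height (pole up)    = 6
height (ring up k0) = 6
height (ring up k1) = 7
height (ring up k2) = 9
height (ring up k3) = 10
height (ring up k4) = 9
height (ring up k5) = 7
height (pole dn)    = 4
height (ring dn k0) = 4
height (ring dn k1) = 3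
height (ring dn k2) = 1
height (ring dn k3) = 0
height (ring dn k4) = 1
height (ring dn k5) = 3

vertex : VRef → Point
vertex (i , v) = xOffset v + quad i , height v

-- The end nearer to the horizontal axis comes first.
ringEnds : Pos → Pos × Pos
ringEnds k0 = k0 , k1
ringEnds k1 = k1 , k2
ringEnds k2 = k2 , k3
ringEnds k3 = k4 , k3
ringEnds k4 = k5 , k4
ringEnds k5 = k0 , k5

lo hi : ERef → VRef
lo (i , vert)      = i , pole dn
lo (i , link)      = i , ring dn k0
lo (i , ring up k) = i , ring up (proj₁ (ringEnds k))
lo (i , ring dn k) = i , ring dn (proj₂ (ringEnds k))
lo (i , pullˡ up)  = i , pole up
lo (i , pullˡ dn)  = i , ring dn k1
lo (i , pullʳ up)  = suc i , pole up
lo (i , pullʳ dn)  = i , ring dn k5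
hi (i , vert)      = i , pole up
hi (i , link)      = i , ring up k0
hi (i , ring up k) = i , ring up (proj₂ (ringEnds k))
hi (i , ring dn k) = i , ring dn (proj₁ (ringEnds k))
hi (i , pullˡ up)  = i , ring up k1
hi (i , pullˡ dn)  = i , pole dn
hi (i , pullʳ up)  = i , ring up k5
hi (i , pullʳ dn)  = suc i , pole dn

edge : ERef → Edge
edge q = vertex (lo q) , vertex (hi q)

divMod4 : ℕ → ℕ × ℕ
divMod4 (suc (suc (suc (suc x)))) = map₁ suc (divMod4 x)
divMod4 x                         = 0 , x

divMod4-quad : ∀ v i → divMod4 (xOffset v + quad i) ≡ (i , xOffset v)
divMod4-quad (pole _)    zero = refl
divMod4-quad (ring _ k0) zero = refl
divMod4-quad (ring _ k1) zero = refl
divMod4-quad (ring _ k2) zero = refl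
divMod4-quad (ring _ k3) zero = refl
divMod4-quad (ring _ k4) zero = refl
divMod4-quad (ring _ k5) zero = refl
divMod4-quad v@(pole _)    (suc i) = cong (map₁ suc) (divMod4-quad v i)
divMod4-quad v@(ring _ k0) (suc i) = cong (map₁ suc) (divMod4-quad v i)
divMod4-quad v@(ring _ k1) (suc i) = cong (map₁ suc) (divMod4-quad v i)
divMod4-quad v@(ring _ k2) (suc i) = cong (map₁ suc) (divMod4-quad v i)
divMod4-quad v@(ring _ k3) (suc i) = cong (map₁ suc) (divMod4-quad v i)
divMod4-quad v@(ring _ k4) (suc i) = cong (map₁ suc) (divMod4-quad v i)
divMod4-quad v@(ring _ k5) (suc i) = cong (map₁ suc) (divMod4-quad v i)

nameᵛ : ℕ → ℕ → VName
nameᵛ 0 6  = pole up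
nameᵛ 0 _  = pole dn
nameᵛ 1 7  = ring up k1
nameᵛ 1 9  = ring up k2
nameᵛ 1 3  = ring dn k1
nameᵛ 1 _  = ring dn k2
nameᵛ 2 6  = ring up k0
nameᵛ 2 10 = ring up k3
nameᵛ 2 4  = ring dn k0
nameᵛ 2 _  = ring dn k3
nameᵛ _ 7  = ring up k5
nameᵛ _ 9  = ring up k4
nameᵛ _ 3  = ring dn k5
nameᵛ _ _  = ring dn k4

nameᵛ-correct : ∀ v → nameᵛ (xOffset v) (height v) ≡ v
nameᵛ-correct (pole up)    = refl
nameᵛ-correct (pole dn)    = refl
nameᵛ-correct (ring up k0) = refl
nameᵛ-correct (ring up k1) = refl
nameᵛ-correct (ring up k2) = refl
nameᵛ-correct (ring up k3) = refl
nameᵛ-correct (ring up k4) = refl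
nameᵛ-correct (ring up k5) = refl
nameᵛ-correct (ring dn k0) = refl
nameᵛ-correct (ring dn k1) = refl
nameᵛ-correct (ring dn k2) = refl
nameᵛ-correct (ring dn k3) = refl
nameᵛ-correct (ring dn k4) = refl
nameᵛ-correct (ring dn k5) = refl

decodeᵛ : Point → VRef
decodeᵛ (x , y) = proj₁ (divMod4 x) , nameᵛ (proj₂ (divMod4 x)) y

decodeᵛ-vertex : ∀ p → decodeᵛ (vertex p) ≡ p
decodeᵛ-vertex (i , v) rewrite divMod4-quad v i = cong (i ,_) (nameᵛ-correct v)

vertex-injective : ∀ {p q} → vertex p ≡ vertex q → p ≡ q
vertex-injective {p} {q} eq = trans (sym (decodeᵛ-vertex p)) (trans (cong decodeᵛ eq) (decodeᵛ-vertex q))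

ringName : Pos → Pos → Pos
ringName k0 k5 = k5
ringName k0 _  = k0
ringName k4 _  = k3
ringName k5 _  = k4
ringName k  _  = k

nameᵉ : VName → VName → EName
nameᵉ (pole dn)    (pole up)    = vert
nameᵉ (ring dn _)  (ring up _)  = link
nameᵉ (ring up j)  (ring up k)  = ring up (ringName j k)
nameᵉ (ring dn j)  (ring dn k)  = ring dn (ringName k j)
nameᵉ (pole up)    (ring up k1) = pullˡ up
nameᵉ (ring dn k1) (pole dn)    = pullˡ dn
nameᵉ (pole up)    (ring up k5) = pullʳ up
nameᵉ (ring dn k5) (pole dn)    = pullʳ dn
nameᵉ _            _            = vert

decodeʳ : VRef → VRef → ERef
decodeʳ (i , v) (j , w) = i ⊓ j , nameᵉ v w

decodeʳ-ends : ∀ q → decodeʳ (lo q) (hi q) ≡ q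
decodeʳ-ends (i , vert)       = cong (_, vert) (ℕ.⊓-idem i)
decodeʳ-ends (i , link)       = cong (_, link) (ℕ.⊓-idem i)
decodeʳ-ends (i , ring up k0) = cong (_, ring up k0) (ℕ.⊓-idem i)
decodeʳ-ends (i , ring up k1) = cong (_, ring up k1) (ℕ.⊓-idem i)
decodeʳ-ends (i , ring up k2) = cong (_, ring up k2) (ℕ.⊓-idem i)
decodeʳ-ends (i , ring up k3) = cong (_, ring up k3) (ℕ.⊓-idem i)
decodeʳ-ends (i , ring up k4) = cong (_, ring up k4) (ℕ.⊓-idem i)
decodeʳ-ends (i , ring up k5) = cong (_, ring up k5) (ℕ.⊓-idem i)
decodeʳ-ends (i , ring dn k0) = cong (_, ring dn k0) (ℕ.⊓-idem i)
decodeʳ-ends (i , ring dn k1) = cong (_, ring dn k1) (ℕ.⊓-idem i)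
decodeʳ-ends (i , ring dn k2) = cong (_, ring dn k2) (ℕ.⊓-idem i)
decodeʳ-ends (i , ring dn k3) = cong (_, ring dn k3) (ℕ.⊓-idem i)
decodeʳ-ends (i , ring dn k4) = cong (_, ring dn k4) (ℕ.⊓-idem i)
decodeʳ-ends (i , ring dn k5) = cong (_, ring dn k5) (ℕ.⊓-idem i)
decodeʳ-ends (i , pullˡ up)   = cong (_, pullˡ up) (ℕ.⊓-idem i)
decodeʳ-ends (i , pullˡ dn)   = cong (_, pullˡ dn) (ℕ.⊓-idem i)
decodeʳ-ends (i , pullʳ up)   = cong (_, pullʳ up) (ℕ.m≥n⇒m⊓n≡n (ℕ.n≤1+n i))
decodeʳ-ends (i , pullʳ dn)   = cong (_, pullʳ dn) (ℕ.m≤n⇒m⊓n≡m (ℕ.n≤1+n i))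

decode : Edge → ERef
decode (u , v) = decodeʳ (decodeᵛ u) (decodeᵛ v)

decode-edge : ∀ q → decode (edge q) ≡ q
decode-edge q = trans (cong₂ decodeʳ (decodeᵛ-vertex (lo q)) (decodeᵛ-vertex (hi q))) (decodeʳ-ends q)

edge-injective : ∀ {p q} → edge p ≡ edge q → p ≡ q
edge-injective {p} {q} eq = trans (sym (decode-edge p)) (trans (cong decode eq) (decode-edge q))

fragmentVertices : ℕ → List VRef
fragmentVertices i =
    (i , ring dn k1) ∷ (i , ring dn k0) ∷ (i , ring up k0) ∷ (i , ring up k1) ∷ (i , pole up) ∷ (i , pole dn)
  ∷ (i , ring dn k5) ∷ (suc i , pole dn) ∷ (suc i , pole up) ∷ (i , ring up k5) ∷ (i , ring up k0) ∷ (i , ring dn k0)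
  ∷ (i , ring up k0) ∷ (i , ring up k5) ∷ (i , ring up k4) ∷ (i , ring up k3) ∷ (i , ring up k2) ∷ (i , ring up k1)
  ∷ (i , ring dn k3) ∷ (i , ring dn k4) ∷ (i , ring dn k5) ∷ (i , ring dn k0) ∷ (i , ring dn k1) ∷ (i , ring dn k2)
  ∷ []

fragmentEdges : ℕ → List ERef
fragmentEdges i =
    (i , ring dn k0) ∷ (i , link) ∷ (i , ring up k0) ∷ (i , pullˡ dn) ∷ (i , vert) ∷ (i , pullˡ up)
  ∷ (i , pullʳ dn) ∷ (suc i , vert) ∷ (i , pullʳ up) ∷ (i , ring dn k5) ∷ (i , link) ∷ (i , ring up k5)
  ∷ (i , ring up k5) ∷ (i , ring up k4) ∷ (i , ring up k3) ∷ (i , ring up k0) ∷ (i , ring up k1) ∷ (i , ring up k2)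
  ∷ (i , ring dn k3) ∷ (i , ring dn k4) ∷ (i , ring dn k5) ∷ (i , ring dn k2) ∷ (i , ring dn k1) ∷ (i , ring dn k0)
  ∷ []

pyreneFragment≡ : ∀ i → pyreneFragment i ≡ (quad i , 3) ∷ (2 + quad i , 3) ∷ (1 + quad i , 6) ∷ (1 + quad i , 0) ∷ []
pyreneFragment≡ i rewrite quad≡4* i | ℕ.+-comm (4 * i) 2 | ℕ.+-comm (4 * i) 1 = refl

corners-fragment : ∀ i → concatMap corners (pyreneFragment i) ≡ map vertex (fragmentVertices i)
corners-fragment i = cong (concatMap corners) (pyreneFragment≡ i)

sides-fragment : ∀ i → concatMap sides (pyreneFragment i) ≡ map edge (fragmentEdges i)
sides-fragment i = cong (concatMap sides) (pyreneFragment≡ i)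

-- The junk reference (0 , vert) is in bounds for n = 0.
InBoundsᵛ : ℕ → VRef → Set
InBoundsᵛ n (i , pole _)   = i ≤ n
InBoundsᵛ n (i , ring _ _) = i < n

InBoundsᵉ : ℕ → ERef → Set
InBoundsᵉ n (i , vert)     = i ≤ n
InBoundsᵉ n (i , link)     = i < n
InBoundsᵉ n (i , ring _ _) = i < n
InBoundsᵉ n (i , pullˡ _)  = i < n
InBoundsᵉ n (i , pullʳ _)  = i < n

fragmentVertices-inBounds : ∀ {n i} → i < n → All (InBoundsᵛ n) (fragmentVertices i)
fragmentVertices-inBounds {n} {i} i<n =
  i<n ∷ i<n ∷ i<n ∷ i<n ∷ i≤n ∷ i≤n ∷ i<n ∷ i<n ∷ i<n ∷ i<n ∷ i<n ∷ i<n ∷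
  i<n ∷ i<n ∷ i<n ∷ i<n ∷ i<n ∷ i<n ∷ i<n ∷ i<n ∷ i<n ∷ i<n ∷ i<n ∷ i<n ∷ []
  where
  i≤n : i ≤ n
  i≤n = ℕ.<⇒≤ i<n

fragmentEdges-inBounds : ∀ {n i} → i < n → All (InBoundsᵉ n) (fragmentEdges i)
fragmentEdges-inBounds {n} {i} i<n =
  i<n ∷ i<n ∷ i<n ∷ i<n ∷ ℕ.<⇒≤ i<n ∷ i<n ∷ i<n ∷ i<n ∷ i<n ∷ i<n ∷ i<n ∷ i<n ∷
  i<n ∷ i<n ∷ i<n ∷ i<n ∷ i<n ∷ i<n ∷ i<n ∷ i<n ∷ i<n ∷ i<n ∷ i<n ∷ i<n ∷ []

inBoundsᵛ⇒∈fragment : ∀ {n} → 0 < n → ∀ p → InBoundsᵛ n p → ∃ λ i → i < n × p ∈ fragmentVertices i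
inBoundsᵛ⇒∈fragment 0<n (zero  , pole up) _ = 0 , 0<n , ∈-lookup {xs = fragmentVertices 0} (# 4)
inBoundsᵛ⇒∈fragment 0<n (zero  , pole dn) _ = 0 , 0<n , ∈-lookup {xs = fragmentVertices 0} (# 5)
inBoundsᵛ⇒∈fragment _   (suc i , pole up) b = i , b , ∈-lookup {xs = fragmentVertices i} (# 8)
inBoundsᵛ⇒∈fragment _   (suc i , pole dn) b = i , b , ∈-lookup {xs = fragmentVertices i} (# 7)
inBoundsᵛ⇒∈fragment _   (i , ring up k0)  b = i , b , ∈-lookup {xs = fragmentVertices i} (# 2)
inBoundsᵛ⇒∈fragment _   (i , ring up k1)  b = i , b , ∈-lookup {xs = fragmentVertices i} (# 3)
inBoundsᵛ⇒∈fragment _   (i , ring up k2)  b = i , b , ∈-lookup {xs = fragmentVertices i} (# 16)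
inBoundsᵛ⇒∈fragment _   (i , ring up k3)  b = i , b , ∈-lookup {xs = fragmentVertices i} (# 15)
inBoundsᵛ⇒∈fragment _   (i , ring up k4)  b = i , b , ∈-lookup {xs = fragmentVertices i} (# 14)
inBoundsᵛ⇒∈fragment _   (i , ring up k5)  b = i , b , ∈-lookup {xs = fragmentVertices i} (# 13)
inBoundsᵛ⇒∈fragment _   (i , ring dn k0)  b = i , b , ∈-lookup {xs = fragmentVertices i} (# 1)
inBoundsᵛ⇒∈fragment _   (i , ring dn k1)  b = i , b , ∈-lookup {xs = fragmentVertices i} (# 0)
inBoundsᵛ⇒∈fragment _   (i , ring dn k2)  b = i , b , ∈-lookup {xs = fragmentVertices i} (# 23)
inBoundsᵛ⇒∈fragment _   (i , ring dn k3)  b = i , b , ∈-lookup {xs = fragmentVertices i} (# 18)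
inBoundsᵛ⇒∈fragment _   (i , ring dn k4)  b = i , b , ∈-lookup {xs = fragmentVertices i} (# 19)
inBoundsᵛ⇒∈fragment _   (i , ring dn k5)  b = i , b , ∈-lookup {xs = fragmentVertices i} (# 20)

inBoundsᵉ⇒∈fragment : ∀ {n} → 0 < n → ∀ q → InBoundsᵉ n q → ∃ λ i → i < n × q ∈ fragmentEdges i
inBoundsᵉ⇒∈fragment 0<n (zero  , vert)   _ = 0 , 0<n , ∈-lookup {xs = fragmentEdges 0} (# 4)
inBoundsᵉ⇒∈fragment _   (suc i , vert)   b = i , b , ∈-lookup {xs = fragmentEdges i} (# 7)
inBoundsᵉ⇒∈fragment _   (i , link)       b = i , b , ∈-lookup {xs = fragmentEdges i} (# 1)
inBoundsᵉ⇒∈fragment _   (i , ring up k0) b = i , b , ∈-lookup {xs = fragmentEdges i} (# 2)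
inBoundsᵉ⇒∈fragment _   (i , ring up k1) b = i , b , ∈-lookup {xs = fragmentEdges i} (# 16)
inBoundsᵉ⇒∈fragment _   (i , ring up k2) b = i , b , ∈-lookup {xs = fragmentEdges i} (# 17)
inBoundsᵉ⇒∈fragment _   (i , ring up k3) b = i , b , ∈-lookup {xs = fragmentEdges i} (# 14)
inBoundsᵉ⇒∈fragment _   (i , ring up k4) b = i , b , ∈-lookup {xs = fragmentEdges i} (# 13)
inBoundsᵉ⇒∈fragment _   (i , ring up k5) b = i , b , ∈-lookup {xs = fragmentEdges i} (# 12)
inBoundsᵉ⇒∈fragment _   (i , ring dn k0) b = i , b , ∈-lookup {xs = fragmentEdges i} (# 0)
inBoundsᵉ⇒∈fragment _   (i , ring dn k1) b = i , b , ∈-lookup {xs = fragmentEdges i} (# 22)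
inBoundsᵉ⇒∈fragment _   (i , ring dn k2) b = i , b , ∈-lookup {xs = fragmentEdges i} (# 21)
inBoundsᵉ⇒∈fragment _   (i , ring dn k3) b = i , b , ∈-lookup {xs = fragmentEdges i} (# 18)
inBoundsᵉ⇒∈fragment _   (i , ring dn k4) b = i , b , ∈-lookup {xs = fragmentEdges i} (# 19)
inBoundsᵉ⇒∈fragment _   (i , ring dn k5) b = i , b , ∈-lookup {xs = fragmentEdges i} (# 20)
inBoundsᵉ⇒∈fragment _   (i , pullˡ up)   b = i , b , ∈-lookup {xs = fragmentEdges i} (# 5)
inBoundsᵉ⇒∈fragment _   (i , pullˡ dn)   b = i , b , ∈-lookup {xs = fragmentEdges i} (# 3)
inBoundsᵉ⇒∈fragment _   (i , pullʳ up)   b = i , b , ∈-lookup {xs = fragmentEdges i} (# 8)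
inBoundsᵉ⇒∈fragment _   (i , pullʳ dn)   b = i , b , ∈-lookup {xs = fragmentEdges i} (# 6)

module _ {B : Set} (f : Hexagon → List B) where

  ∈-fragments⁺ : ∀ {n i y} → i < n → y ∈ concatMap f (pyreneFragment i) →
                 y ∈ concatMap f (concatMap pyreneFragment (upTo n))
  ∈-fragments⁺ {i = i} i<n y∈ with h , h∈ , y∈h ← find (∈-concatMap⁻ f {xs = pyreneFragment i} y∈) =
    ∈-concatMap⁺ f (lose (∈-concatMap⁺ pyreneFragment (lose (∈-upTo⁺ i<n) h∈)) y∈h)

  ∈-fragments⁻ : ∀ {n y} → y ∈ concatMap f (concatMap pyreneFragment (upTo n)) →
                 ∃ λ i → i < n × y ∈ concatMap f (pyreneFragment i)
  ∈-fragments⁻ {n} y∈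
    with h , h∈ , y∈h ← find (∈-concatMap⁻ f {xs = concatMap pyreneFragment (upTo n)} y∈)
    with i , i∈ , h∈i ← find (∈-concatMap⁻ pyreneFragment {xs = upTo n} h∈) =
    i , ∈-upTo⁻ i∈ , ∈-concatMap⁺ f (lose h∈i y∈h)

∈-V⁺ : ∀ {n p} → 0 < n → InBoundsᵛ n p → vertex p ∈ V (H n)
∈-V⁺ {n} {p} 0<n b with i , i<n , p∈ ← inBoundsᵛ⇒∈fragment 0<n p b =
  ∈-deduplicate⁺ _≟ᴾ_ (∈-fragments⁺ corners i<n (subst (vertex p ∈_) (sym (corners-fragment i)) (∈-map⁺ vertex p∈)))

∈-V⁻ : ∀ {n v} → v ∈ V (H n) → ∃ λ p → InBoundsᵛ n p × v ≡ vertex p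
∈-V⁻ {n} {v} v∈
  with i , i<n , v∈i ← ∈-fragments⁻ corners {n} (∈-deduplicate⁻ _≟ᴾ_ _ v∈)
  with p , p∈ , v≡ ← ∈-map⁻ vertex (subst (v ∈_) (corners-fragment i) v∈i) =
  p , All.lookup (fragmentVertices-inBounds i<n) p∈ , v≡

∈-E⁺ : ∀ {n q} → 0 < n → InBoundsᵉ n q → edge q ∈ E (H n)
∈-E⁺ {n} {q} 0<n b with i , i<n , q∈ ← inBoundsᵉ⇒∈fragment 0<n q b =
  ∈-deduplicate⁺ _≟ᴱ_ (∈-fragments⁺ sides i<n (subst (edge q ∈_) (sym (sides-fragment i)) (∈-map⁺ edge q∈)))

∈-E⁻ : ∀ {n e} → e ∈ E (H n) → ∃ λ q → InBoundsᵉ n q × e ≡ edge q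
∈-E⁻ {n} {e} e∈
  with i , i<n , e∈i ← ∈-fragments⁻ sides {n} (∈-deduplicate⁻ _≟ᴱ_ _ e∈)
  with q , q∈ , e≡ ← ∈-map⁻ edge (subst (e ∈_) (sides-fragment i) e∈i) =
  q , All.lookup (fragmentEdges-inBounds i<n) q∈ , e≡

ringIncidence : Side → Pos → List EName
ringIncidence s k0 = ring s k0 ∷ ring s k5 ∷ link ∷ []
ringIncidence s k1 = ring s k0 ∷ ring s k1 ∷ pullˡ s ∷ []
ringIncidence s k2 = ring s k1 ∷ ring s k2 ∷ []
ringIncidence s k3 = ring s k2 ∷ ring s k3 ∷ []
ringIncidence s k4 = ring s k3 ∷ ring s k4 ∷ []
ringIncidence s k5 = ring s k4 ∷ ring s k5 ∷ pullʳ s ∷ []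

incidence : VRef → List ERef
incidence (i     , ring s k) = map (i ,_) (ringIncidence s k)
incidence (zero  , pole s)   = (0 , vert) ∷ (0 , pullˡ s) ∷ []
incidence (suc i , pole s)   = (suc i , vert) ∷ (suc i , pullˡ s) ∷ (i , pullʳ s) ∷ []

∈-incidence-lo : ∀ q → q ∈ incidence (lo q)
∈-incidence-lo (zero  , vert)        = here refl
∈-incidence-lo (suc i , vert)        = here refl
∈-incidence-lo (i , link)            = there (there (here refl))
∈-incidence-lo (i , ring up k0)      = here refl
∈-incidence-lo (i , ring up k1)      = there (here refl)
∈-incidence-lo (i , ring up k2)      = there (here refl)
∈-incidence-lo (i , ring up k3)      = here refl
∈-incidence-lo (i , ring up k4)      = here refl
∈-incidence-lo (i , ring up k5)      = there (here refl)
∈-incidence-lo (i , ring dn k0)      = here refl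
∈-incidence-lo (i , ring dn k1)      = here refl
∈-incidence-lo (i , ring dn k2)      = here refl
∈-incidence-lo (i , ring dn k3)      = there (here refl)
∈-incidence-lo (i , ring dn k4)      = there (here refl)
∈-incidence-lo (i , ring dn k5)      = there (here refl)
∈-incidence-lo (zero  , pullˡ up)    = there (here refl)
∈-incidence-lo (suc i , pullˡ up)    = there (here refl)
∈-incidence-lo (i , pullˡ dn)        = there (there (here refl))
∈-incidence-lo (i , pullʳ up)        = there (there (here refl))
∈-incidence-lo (i , pullʳ dn)        = there (there (here refl))

∈-incidence-hi : ∀ q → q ∈ incidence (hi q)
∈-incidence-hi (zero  , vert)        = here refl
∈-incidence-hi (suc i , vert)        = here refl
∈-incidence-hi (i , link)            = there (there (here refl))
∈-incidence-hi (i , ring up k0)      = here refl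
∈-incidence-hi (i , ring up k1)      = here refl
∈-incidence-hi (i , ring up k2)      = here refl
∈-incidence-hi (i , ring up k3)      = there (here refl)
∈-incidence-hi (i , ring up k4)      = there (here refl)
∈-incidence-hi (i , ring up k5)      = there (here refl)
∈-incidence-hi (i , ring dn k0)      = here refl
∈-incidence-hi (i , ring dn k1)      = there (here refl)
∈-incidence-hi (i , ring dn k2)      = there (here refl)
∈-incidence-hi (i , ring dn k3)      = here refl
∈-incidence-hi (i , ring dn k4)      = here refl
∈-incidence-hi (i , ring dn k5)      = there (here refl)
∈-incidence-hi (i , pullˡ up)        = there (there (here refl))
∈-incidence-hi (zero  , pullˡ dn)    = there (here refl)
∈-incidence-hi (suc i , pullˡ dn)    = there (here refl)
∈-incidence-hi (i , pullʳ up)        = there (there (here refl))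
∈-incidence-hi (i , pullʳ dn)        = there (there (here refl))

incidence-sound : ∀ p → All (λ q → p ≡ lo q ⊎ p ≡ hi q) (incidence p)
incidence-sound (zero  , pole up) = inj₂ refl ∷ inj₁ refl ∷ []
incidence-sound (zero  , pole dn) = inj₁ refl ∷ inj₂ refl ∷ []
incidence-sound (suc i , pole up) = inj₂ refl ∷ inj₁ refl ∷ inj₁ refl ∷ []
incidence-sound (suc i , pole dn) = inj₁ refl ∷ inj₂ refl ∷ inj₂ refl ∷ []
incidence-sound (i , ring up k0)  = inj₁ refl ∷ inj₁ refl ∷ inj₂ refl ∷ []
incidence-sound (i , ring up k1)  = inj₂ refl ∷ inj₁ refl ∷ inj₂ refl ∷ []
incidence-sound (i , ring up k2)  = inj₂ refl ∷ inj₁ refl ∷ []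
incidence-sound (i , ring up k3)  = inj₂ refl ∷ inj₂ refl ∷ []
incidence-sound (i , ring up k4)  = inj₁ refl ∷ inj₂ refl ∷ []
incidence-sound (i , ring up k5)  = inj₁ refl ∷ inj₂ refl ∷ inj₂ refl ∷ []
incidence-sound (i , ring dn k0)  = inj₂ refl ∷ inj₂ refl ∷ inj₁ refl ∷ []
incidence-sound (i , ring dn k1)  = inj₁ refl ∷ inj₂ refl ∷ inj₁ refl ∷ []
incidence-sound (i , ring dn k2)  = inj₁ refl ∷ inj₂ refl ∷ []
incidence-sound (i , ring dn k3)  = inj₁ refl ∷ inj₁ refl ∷ []
incidence-sound (i , ring dn k4)  = inj₂ refl ∷ inj₁ refl ∷ []
incidence-sound (i , ring dn k5)  = inj₂ refl ∷ inj₁ refl ∷ inj₁ refl ∷ []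

∈-incidence⁺ : ∀ p q → Incident (vertex p) (edge q) → q ∈ incidence p
∈-incidence⁺ p q (inj₁ eq) rewrite vertex-injective {p} {lo q} eq = ∈-incidence-lo q
∈-incidence⁺ p q (inj₂ eq) rewrite vertex-injective {p} {hi q} eq = ∈-incidence-hi q

∈-incidence⁻ : ∀ p q → q ∈ incidence p → Incident (vertex p) (edge q)
∈-incidence⁻ p q q∈ with All.lookup (incidence-sound p) q∈
... | inj₁ eq = inj₁ (cong vertex eq)
... | inj₂ eq = inj₂ (cong vertex eq)

incidence-unique : ∀ p → Unique (incidence p)
incidence-unique (zero  , pole s) = ((λ ()) ∷ []) ∷ [] ∷ []
incidence-unique (suc i , pole s) = ((λ ()) ∷ (λ ()) ∷ []) ∷ ((λ ()) ∷ []) ∷ [] ∷ []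
incidence-unique (i , ring s k0)  = ((λ ()) ∷ (λ ()) ∷ []) ∷ ((λ ()) ∷ []) ∷ [] ∷ []
incidence-unique (i , ring s k1)  = ((λ ()) ∷ (λ ()) ∷ []) ∷ ((λ ()) ∷ []) ∷ [] ∷ []
incidence-unique (i , ring s k2)  = ((λ ()) ∷ []) ∷ [] ∷ []
incidence-unique (i , ring s k3)  = ((λ ()) ∷ []) ∷ [] ∷ []
incidence-unique (i , ring s k4)  = ((λ ()) ∷ []) ∷ [] ∷ []
incidence-unique (i , ring s k5)  = ((λ ()) ∷ (λ ()) ∷ []) ∷ ((λ ()) ∷ []) ∷ [] ∷ []

Selection : Set
Selection = ERef → Bool

bit : Bool → ℕ
bit false = 0
bit true  = 1

count : ∀ {A : Set} → (A → Bool) → List A → ℕ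
count m []       = 0
count m (q ∷ qs) = bit (m q) + count m qs

selected : List Edge → Selection
selected M q = does (edge q ∈? M)

count-selected : ∀ M qs → length (filter (_∈? M) (map edge qs)) ≡ count (selected M) qs
count-selected M [] = refl
count-selected M (q ∷ qs) with edge q ∈? M
... | yes _ = cong suc (count-selected M qs)
... | no  _ = count-selected M qs

degree : ∀ {M} → Unique M → (∀ {e} → e ∈ M → ∃ λ q → e ≡ edge q) → ∀ p →
         length (filter (incident? (vertex p)) M) ≡ count (selected M) (incidence p)
degree {M} M! named p = trans
  (↭.↭-length (unique-set⇒↭ (Unique.filter⁺ (incident? (vertex p)) M!)
    (Unique.filter⁺ (_∈? M) (Unique.map⁺ edge-injective (incidence-unique p))) to from))
  (count-selected M (incidence p))
  where
  to′ : ∀ {e} → e ∈ M → Incident (vertex p) e → ∃ (λ q → e ≡ edge q) → e ∈ map edge (incidence p)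
  to′ e∈M inc (q , refl) = ∈-map⁺ edge (∈-incidence⁺ p q inc)
  to : ∀ {e} → e ∈ filter (incident? (vertex p)) M → e ∈ filter (_∈? M) (map edge (incidence p))
  to e∈ = let e∈M , inc = ∈-filter⁻ (incident? (vertex p)) {xs = M} e∈ in
    ∈-filter⁺ (_∈? M) (to′ e∈M inc (named e∈M)) e∈M
  from′ : ∀ {e} → ∃ (λ q → q ∈ incidence p × e ≡ edge q) → Incident (vertex p) e
  from′ (q , q∈ , refl) = ∈-incidence⁻ p q q∈
  from : ∀ {e} → e ∈ filter (_∈? M) (map edge (incidence p)) → e ∈ filter (incident? (vertex p)) M
  from e∈ = let e∈inc , e∈M = ∈-filter⁻ (_∈? M) {xs = map edge (incidence p)} e∈ in
    ∈-filter⁺ (incident? (vertex p)) e∈M (from′ (∈-map⁻ edge e∈inc))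

degree-subset : ∀ {n M} → M ∈ subsets (E (H n)) → ∀ p →
                length (filter (incident? (vertex p)) M) ≡ count (selected M) (incidence p)
degree-subset {n} {M} M∈ = degree (subset-unique (E! (H n)) M∈) named
  where
  named : ∀ {e} → e ∈ M → ∃ λ q → e ≡ edge q
  named e∈ = let q , _ , eq = ∈-E⁻ {n} (∈-subsets⇒⊆ (E (H n)) M∈ e∈) in q , eq

Balanced : ℕ → Selection → Set
Balanced n m = ∀ p → InBoundsᵛ n p → count m (incidence p) ≡ 1

perfect⇒balanced : ∀ {n M} → 0 < n → M ∈ perfectMatchings (H n) → Balanced n (selected M)
perfect⇒balanced {n} 0<n M∈ p b =
  let M∈sub , perf = ∈-filter⁻ (perfect? (H n)) {xs = subsets (E (H n))} M∈ in
  trans (sym (degree-subset {n} M∈sub p)) (All.lookup perf (∈-V⁺ {n} 0<n b))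

balanced⇒perfect : ∀ {n M} → M ∈ subsets (E (H n)) → Balanced n (selected M) → M ∈ perfectMatchings (H n)
balanced⇒perfect {n} {M} M∈ bal = ∈-filter⁺ (perfect? (H n)) M∈ (All.tabulate (λ v∈ → perf (∈-V⁻ {n} v∈)))
  where
  perf : ∀ {v} → ∃ (λ p → InBoundsᵛ n p × v ≡ vertex p) → length (filter (incident? v) M) ≡ 1
  perf (p , b , refl) = trans (degree-subset {n} M∈ p) (bal p b)

matching : ℕ → Selection → List Edge
matching n m = filter (λ e → T? (m (decode e))) (E (H n))

∈-matching⁺ : ∀ {n m q} → 0 < n → InBoundsᵉ n q → m q ≡ true → edge q ∈ matching n m
∈-matching⁺ {n} {m} {q} 0<n b mq = ∈-filter⁺ (λ e → T? (m (decode e))) (∈-E⁺ {n} {q} 0<n b)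
  (subst T (sym (trans (cong m (decode-edge q)) mq)) _)

∈-matching⁻ : ∀ {n m q} → edge q ∈ matching n m → InBoundsᵉ n q × m q ≡ true
∈-matching⁻ {n} {m} {q} e∈ =
  let e∈E , t = ∈-filter⁻ (λ e → T? (m (decode e))) {xs = E (H n)} e∈ in
  inBounds (∈-E⁻ {n} e∈E) , trans (cong m (sym (decode-edge q))) (T⇒≡true t)
  where
  T⇒≡true : ∀ {x} → T x → x ≡ true
  T⇒≡true {true} _ = refl
  inBounds : ∃ (λ q′ → InBoundsᵉ n q′ × edge q ≡ edge q′) → InBoundsᵉ n q
  inBounds (q′ , b , eq) = subst (InBoundsᵉ n) (sym (edge-injective eq)) b

-- Perfect matchings as words

data Phase : Set where
  α β : Phase

data Letter : Set where
  hex : Phase → Phase → Letter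
  L R : Letter

isL isR : Letter → Bool
isL L = true
isL R = false
isL (hex _ _) = false
isR R = true
isR L = false
isR (hex _ _) = false

on : Phase → Pos → Bool
on α k0 = true
on α k1 = false
on α k2 = true
on α k3 = false
on α k4 = true
on α k5 = false
on β k0 = false
on β k1 = true
on β k2 = false
on β k3 = true
on β k4 = false
on β k5 = true

onL onR : Pos → Bool
onL k0 = false
onL k1 = false
onL k2 = true
onL k3 = false
onL k4 = true
onL k5 = false
onR k0 = false
onR k1 = true
onR k2 = false
onR k3 = true
onR k4 = false
onR k5 = false

phase : Phase → Phase → Side → Phase
phase x y up = x
phase x y dn = y

-- vert is shared between fragments, so its value here is junk.
inside : Letter → EName → Bool
inside l         vert       = false
inside l         link       = isL l ∨ isR l
inside (hex x y) (ring s k) = on (phase x y s) k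
inside L         (ring s k) = onL k
inside R         (ring s k) = onR k
inside l         (pullˡ s)  = isL l
inside l         (pullʳ s)  = isR l

Word : Set
Word = ℕ → Letter

prevR : Word → ℕ → Bool
prevR f zero    = false
prevR f (suc i) = isR (f i)

select : Word → Selection
select f (i , vert)       = not (prevR f i) ∧ not (isL (f i))
select f (i , e@link)     = inside (f i) e
select f (i , e@(ring _ _)) = inside (f i) e
select f (i , e@(pullˡ _))  = inside (f i) e
select f (i , e@(pullʳ _))  = inside (f i) e

Legal : Word → Set
Legal f = ∀ i → isR (f i) ∧ isL (f (suc i)) ≡ false

inside-balanced : ∀ l s k → count (inside l) (ringIncidence s k) ≡ 1
inside-balanced L s k0 = refl
inside-balanced L s k1 = refl
inside-balanced L s k2 = refl
inside-balanced L s k3 = refl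
inside-balanced L s k4 = refl
inside-balanced L s k5 = refl
inside-balanced R s k0 = refl
inside-balanced R s k1 = refl
inside-balanced R s k2 = refl
inside-balanced R s k3 = refl
inside-balanced R s k4 = refl
inside-balanced R s k5 = refl
inside-balanced (hex x y) s k0 with phase x y s
... | α = refl
... | β = refl
inside-balanced (hex x y) s k1 with phase x y s
... | α = refl
... | β = refl
inside-balanced (hex x y) s k2 with phase x y s
... | α = refl
... | β = refl
inside-balanced (hex x y) s k3 with phase x y s
... | α = refl
... | β = refl
inside-balanced (hex x y) s k4 with phase x y s
... | α = refl
... | β = refl
inside-balanced (hex x y) s k5 with phase x y s
... | α = refl
... | β = refl

select-balanced : ∀ {f} → Legal f → ∀ p → count (select f) (incidence p) ≡ 1
select-balanced {f} leg (zero , pole s) with isL (f 0)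
... | false = refl
... | true  = refl
select-balanced {f} leg (suc i , pole s) with isR (f i) | isL (f (suc i)) | leg i
... | false | false | _ = refl
... | false | true  | _ = refl
... | true  | false | _ = refl
select-balanced {f} leg (i , ring s k0) = inside-balanced (f i) s k0
select-balanced {f} leg (i , ring s k1) = inside-balanced (f i) s k1
select-balanced {f} leg (i , ring s k2) = inside-balanced (f i) s k2
select-balanced {f} leg (i , ring s k3) = inside-balanced (f i) s k3
select-balanced {f} leg (i , ring s k4) = inside-balanced (f i) s k4
select-balanced {f} leg (i , ring s k5) = inside-balanced (f i) s k5

data RingState : Set where
  phased : Phase → RingState
  pulledˡ pulledʳ : RingState

stateOn : RingState → Pos → Bool
stateOn (phased x) = on x
stateOn pulledˡ    = onL
stateOn pulledʳ    = onR

stateL stateR : RingState → Bool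
stateL (phased _) = false
stateL pulledˡ    = true
stateL pulledʳ    = false
stateR (phased _) = false
stateR pulledˡ    = false
stateR pulledʳ    = true

stateLink : RingState → Bool
stateLink (phased _) = false
stateLink pulledˡ    = true
stateLink pulledʳ    = true

record HasState (g : Pos → Bool) (link pullˡ pullʳ : Bool) (st : RingState) : Set where
  field
    ring-≡  : ∀ k → g k ≡ stateOn st k
    link-≡  : link ≡ stateLink st
    pullˡ-≡ : pullˡ ≡ stateL st
    pullʳ-≡ : pullʳ ≡ stateR st

ring-state : ∀ (g : Pos → Bool) lk l r →
  bit (g k0) + (bit (g k5) + (bit lk + 0)) ≡ 1 →
  bit (g k0) + (bit (g k1) + (bit l + 0)) ≡ 1 →
  bit (g k1) + (bit (g k2) + 0) ≡ 1 →
  bit (g k2) + (bit (g k3) + 0) ≡ 1 →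
  bit (g k3) + (bit (g k4) + 0) ≡ 1 →
  bit (g k4) + (bit (g k5) + (bit r + 0)) ≡ 1 →
  ∃ (HasState g lk l r)
ring-state g lk l r c0 c1 c2 c3 c4 c5 =
  let st , (p0 , p1 , p2 , p3 , p4 , p5) , p6 , p7 , p8 = go (g k0) (g k1) (g k2) (g k3) (g k4) (g k5) lk l r
        (other (g k1) (g k2) c2) (other (g k2) (g k3) c3) (other (g k3) (g k4) c4) c0 c1 c5 in
  st , record
    { ring-≡  = λ { k0 → p0 ; k1 → p1 ; k2 → p2 ; k3 → p3 ; k4 → p4 ; k5 → p5 }
    ; link-≡  = p6
    ; pullˡ-≡ = p7
    ; pullʳ-≡ = p8
    }
  where
  other : ∀ x y → bit x + (bit y + 0) ≡ 1 → y ≡ not x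
  other false true  _ = refl
  other true  false _ = refl
  go : ∀ e0 e1 e2 e3 e4 e5 lk l r → e2 ≡ not e1 → e3 ≡ not e2 → e4 ≡ not e3 →
    bit e0 + (bit e5 + (bit lk + 0)) ≡ 1 → bit e0 + (bit e1 + (bit l + 0)) ≡ 1 → bit e4 + (bit e5 + (bit r + 0)) ≡ 1 →
    ∃ λ st → (e0 ≡ stateOn st k0 × e1 ≡ stateOn st k1 × e2 ≡ stateOn st k2 × e3 ≡ stateOn st k3
              × e4 ≡ stateOn st k4 × e5 ≡ stateOn st k5)
            × lk ≡ stateLink st × l ≡ stateL st × r ≡ stateR st
  go true  true  _ _ _ _ _ _ _ refl refl refl _ () _
  go false true  _ _ _ _ _ true _ refl refl refl _ () _
  go false true  _ _ _ true true false _ refl refl refl () _ _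
  go false true  _ _ _ true false false true refl refl refl _ _ ()
  go false true  _ _ _ true false false false refl refl refl _ _ _ = phased β , (refl , refl , refl , refl , refl , refl) , refl , refl , refl
  go false true  _ _ _ false false false _ refl refl refl () _ _
  go false true  _ _ _ false true false false refl refl refl _ _ ()
  go false true  _ _ _ false true false true refl refl refl _ _ _ = pulledʳ , (refl , refl , refl , refl , refl , refl) , refl , refl , refl
  go _     false _ _ _ true _ _ _ refl refl refl _ _ ()
  go _     false _ _ _ false _ _ true refl refl refl _ _ ()
  go true  false _ _ _ false true _ false refl refl refl () _ _
  go true  false _ _ _ false false true false refl refl refl _ () _
  go true  false _ _ _ false false false false refl refl refl _ _ _ = phased α , (refl , refl , refl , refl , refl , refl) , refl , refl , refl
  go false false _ _ _ false false _ false refl refl refl () _ _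
  go false false _ _ _ false true false false refl refl refl _ () _
  go false false _ _ _ false true true false refl refl refl _ _ _ = pulledˡ , (refl , refl , refl , refl , refl , refl) , refl , refl , refl

record FragmentIs (m : Selection) (i : ℕ) (l : Letter) : Set where
  field
    ring-≡  : ∀ s k → m (i , ring s k) ≡ inside l (ring s k)
    link-≡  : m (i , link) ≡ inside l link
    pullˡ-≡ : ∀ s → m (i , pullˡ s) ≡ isL l
    pullʳ-≡ : ∀ s → m (i , pullʳ s) ≡ isR l

open FragmentIs

fragment-letter : ∀ m i → (∀ s k → count m (incidence (i , ring s k)) ≡ 1) →
                  m (i , pullˡ up) ≡ m (i , pullˡ dn) → ∃ (FragmentIs m i)
fragment-letter m i bal pull-≡ = combine (state up) (state dn)
  where
  state : ∀ s → ∃ (HasState (λ k → m (i , ring s k)) (m (i , link)) (m (i , pullˡ s)) (m (i , pullʳ s)))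
  state s = ring-state _ _ _ _ (bal s k0) (bal s k1) (bal s k2) (bal s k3) (bal s k4) (bal s k5)
  module S = HasState
  combine : ∃ (HasState (λ k → m (i , ring up k)) (m (i , link)) (m (i , pullˡ up)) (m (i , pullʳ up))) →
            ∃ (HasState (λ k → m (i , ring dn k)) (m (i , link)) (m (i , pullˡ dn)) (m (i , pullʳ dn))) →
            ∃ (FragmentIs m i)
  combine (phased x , U) (phased y , D) = hex x y , record
    { ring-≡ = λ { up → S.ring-≡ U ; dn → S.ring-≡ D } ; link-≡ = S.link-≡ U
    ; pullˡ-≡ = λ { up → S.pullˡ-≡ U ; dn → S.pullˡ-≡ D } ; pullʳ-≡ = λ { up → S.pullʳ-≡ U ; dn → S.pullʳ-≡ D } }
  combine (pulledˡ , U) (pulledˡ , D) = L , record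
    { ring-≡ = λ { up → S.ring-≡ U ; dn → S.ring-≡ D } ; link-≡ = S.link-≡ U
    ; pullˡ-≡ = λ { up → S.pullˡ-≡ U ; dn → S.pullˡ-≡ D } ; pullʳ-≡ = λ { up → S.pullʳ-≡ U ; dn → S.pullʳ-≡ D } }
  combine (pulledʳ , U) (pulledʳ , D) = R , record
    { ring-≡ = λ { up → S.ring-≡ U ; dn → S.ring-≡ D } ; link-≡ = S.link-≡ U
    ; pullˡ-≡ = λ { up → S.pullˡ-≡ U ; dn → S.pullˡ-≡ D } ; pullʳ-≡ = λ { up → S.pullʳ-≡ U ; dn → S.pullʳ-≡ D } }
  combine (phased _ , U) (pulledˡ , D) with () ← trans (sym (S.link-≡ U)) (S.link-≡ D)
  combine (phased _ , U) (pulledʳ , D) with () ← trans (sym (S.link-≡ U)) (S.link-≡ D)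
  combine (pulledˡ , U) (phased _ , D) with () ← trans (sym (S.link-≡ U)) (S.link-≡ D)
  combine (pulledʳ , U) (phased _ , D) with () ← trans (sym (S.link-≡ U)) (S.link-≡ D)
  combine (pulledˡ , U) (pulledʳ , D) with () ← trans (sym (S.pullˡ-≡ U)) (trans pull-≡ (S.pullˡ-≡ D))
  combine (pulledʳ , U) (pulledˡ , D) with () ← trans (sym (S.pullˡ-≡ U)) (trans pull-≡ (S.pullˡ-≡ D))

-- The two ends of a vertical side are joined to the same side of it: at the
-- left end of the chain there is no choice, and a fragment carries the
-- property from its left to its right vertical side.
letterAt : ∀ {n m} → Balanced n m → ∀ i → i < n → ∃ (FragmentIs m i)
letterAt {n} {m} bal i i<n = fragment-letter m i (λ s k → bal (i , ring s k) i<n) (pulls-agree i i<n)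
  where
  cancel : ∀ v x y → bit v + (bit x + 0) ≡ 1 → bit v + (bit y + 0) ≡ 1 → x ≡ y
  cancel false true  true  _ _ = refl
  cancel true  false false _ _ = refl
  cancel₃ : ∀ v x y r → bit v + (bit x + (bit r + 0)) ≡ 1 → bit v + (bit y + (bit r + 0)) ≡ 1 → x ≡ y
  cancel₃ _     false false _     _ _ = refl
  cancel₃ _     true  true  _     _ _ = refl
  cancel₃ false false true  false () _
  cancel₃ false false true  true  _ ()
  cancel₃ true  false true  _     _ ()
  cancel₃ false true  false false _ ()
  cancel₃ false true  false true  () _
  cancel₃ true  true  false _     () _
  pulls-agree : ∀ i → i < n → m (i , pullˡ up) ≡ m (i , pullˡ dn)
  pulls-agree zero    i<n = cancel (m (0 , vert)) _ _ (bal (0 , pole up) z≤n) (bal (0 , pole dn) z≤n)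
  pulls-agree (suc i) i<n = cancel₃ (m (suc i , vert)) _ _ (m (i , pullʳ up)) (bal (suc i , pole up) (ℕ.<⇒≤ i<n))
    (subst (λ r → bit (m (suc i , vert)) + (bit (m (suc i , pullˡ dn)) + (bit r + 0)) ≡ 1)
      (trans (pullʳ-≡ frag dn) (sym (pullʳ-≡ frag up))) (bal (suc i , pole dn) (ℕ.<⇒≤ i<n)))
    where
    i<n′ : i < n
    i<n′ = ℕ.<-trans (ℕ.n<1+n i) i<n
    frag : FragmentIs m i (proj₁ (letterAt bal i i<n′))
    frag = proj₂ (letterAt bal i i<n′)

filler : Letter
filler = hex α α

balanced⇒word : ∀ {n m} → Balanced n m → (∀ s → m (n , pullˡ s) ≡ false) →
  ∃ λ f → Legal f × (∀ i → n ≤ i → f i ≡ filler) × (∀ q → InBoundsᵉ n q → m q ≡ select f q)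
balanced⇒word {n} {m} bal edgeless = f , legal , beyond , agrees
  where
  f : Word
  f i with i <? n
  ... | yes i<n = proj₁ (letterAt bal i i<n)
  ... | no  _   = filler

  fragment : ∀ i → i < n → FragmentIs m i (f i)
  fragment i i<n with i <? n
  ... | yes p = proj₂ (letterAt bal i p)
  ... | no i≮n = contradiction i<n i≮n

  beyond : ∀ i → n ≤ i → f i ≡ filler
  beyond i n≤i with i <? n
  ... | yes i<n = contradiction n≤i (ℕ.<⇒≱ i<n)
  ... | no  _   = refl

  pull : ∀ i → i ≤ n → m (i , pullˡ up) ≡ isL (f i)
  pull i i≤n with ℕ.m≤n⇒m<n∨m≡n i≤n
  ... | inj₁ i<n  = pullˡ-≡ (fragment i i<n) up
  ... | inj₂ refl = trans (edgeless up) (sym (cong isL (beyond n ℕ.≤-refl)))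

  pole-≡ : ∀ i → suc i ≤ n → bit (m (suc i , vert)) + (bit (isL (f (suc i))) + (bit (isR (f i)) + 0)) ≡ 1
  pole-≡ i i<n = subst₂ (λ x y → bit (m (suc i , vert)) + (bit x + (bit y + 0)) ≡ 1)
    (pull (suc i) i<n) (pullʳ-≡ (fragment i i<n) up) (bal (suc i , pole up) i<n)

  legal : Legal f
  legal i = go (i <? n)
    where
    exclusive : ∀ v x y → bit v + (bit x + (bit y + 0)) ≡ 1 → y ∧ x ≡ false
    exclusive _     false y     _  = ∧-zeroʳ y
    exclusive _     true  false _  = refl
    exclusive false true  true  ()
    exclusive true  true  true  ()
    go : Dec (i < n) → isR (f i) ∧ isL (f (suc i)) ≡ false
    go (yes i<n) = exclusive (m (suc i , vert)) (isL (f (suc i))) (isR (f i)) (pole-≡ i i<n)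
    go (no  i≮n) = cong (λ l → isR l ∧ isL (f (suc i))) (beyond i (ℕ.≮⇒≥ i≮n))

  agrees : ∀ q → InBoundsᵉ n q → m q ≡ select f q
  agrees (zero  , vert)   i≤n = rest (m (0 , vert)) _ (subst (λ x → bit (m (0 , vert)) + (bit x + 0) ≡ 1) (pull 0 i≤n) (bal (0 , pole up) i≤n))
    where
    rest : ∀ v x → bit v + (bit x + 0) ≡ 1 → v ≡ not x
    rest false true  _ = refl
    rest true  false _ = refl
  agrees (suc i , vert)   i≤n = rest (m (suc i , vert)) (isL (f (suc i))) (isR (f i)) (pole-≡ i i≤n)
    where
    rest : ∀ v x y → bit v + (bit x + (bit y + 0)) ≡ 1 → v ≡ not y ∧ not x
    rest false false true  _ = refl
    rest false true  false _ = refl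
    rest true  false false _ = refl
    rest false true  true  ()
    rest true  true  true  ()
  agrees (i , link)       i<n = link-≡ (fragment i i<n)
  agrees (i , ring s k)   i<n = ring-≡ (fragment i i<n) s k
  agrees (i , pullˡ s)    i<n = pullˡ-≡ (fragment i i<n) s
  agrees (i , pullʳ s)    i<n = pullʳ-≡ (fragment i i<n) s

incidence-inBounds : ∀ {n} → 0 < n → ∀ p → InBoundsᵛ n p →
                     All (λ q → InBoundsᵉ n q ⊎ ∃ λ s → q ≡ (n , pullˡ s)) (incidence p)
incidence-inBounds 0<n (zero  , pole s)  b = inj₁ b ∷ inj₁ 0<n ∷ []
incidence-inBounds 0<n (suc i , pole s)  b = inj₁ b ∷ last (ℕ.m≤n⇒m<n∨m≡n b) ∷ inj₁ b ∷ []
  where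
  last : ∀ {n i} → i < n ⊎ i ≡ n → i < n ⊎ ∃ λ s′ → (i , pullˡ s) ≡ (n , pullˡ s′)
  last (inj₁ i<n)  = inj₁ i<n
  last (inj₂ refl) = inj₂ (s , refl)
incidence-inBounds 0<n (i , ring s k0) b = inj₁ b ∷ inj₁ b ∷ inj₁ b ∷ []
incidence-inBounds 0<n (i , ring s k1) b = inj₁ b ∷ inj₁ b ∷ inj₁ b ∷ []
incidence-inBounds 0<n (i , ring s k2) b = inj₁ b ∷ inj₁ b ∷ []
incidence-inBounds 0<n (i , ring s k3) b = inj₁ b ∷ inj₁ b ∷ []
incidence-inBounds 0<n (i , ring s k4) b = inj₁ b ∷ inj₁ b ∷ []
incidence-inBounds 0<n (i , ring s k5) b = inj₁ b ∷ inj₁ b ∷ inj₁ b ∷ []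

count-cong : ∀ {A : Set} {m m′ : A → Bool} {qs} → All (λ q → m q ≡ m′ q) qs → count m qs ≡ count m′ qs
count-cong []         = refl
count-cong (eq ∷ eqs) = cong₂ (λ x c → bit x + c) eq (count-cong eqs)

wordMatching : ℕ → Word → List Edge
wordMatching n f = matching n (select f)

selected⁻ : ∀ {M q} → selected M q ≡ true → edge q ∈ M
selected⁻ {M} {q} eq with edge q ∈? M
... | yes e∈ = e∈

selected-matching : ∀ {n m q} → 0 < n → InBoundsᵉ n q → selected (matching n m) q ≡ m q
selected-matching {n} {m} {q} 0<n b = go (m q) refl
  where
  go : ∀ x → m q ≡ x → selected (matching n m) q ≡ x
  go true  eq = dec-true (edge q ∈? matching n m) (∈-matching⁺ {n} {m} {q} 0<n b eq)
  go false eq = dec-false (edge q ∈? matching n m) λ e∈ → contradiction (trans (sym eq) (proj₂ (∈-matching⁻ {n} {m} {q} e∈))) λ ()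

selected-oob : ∀ {n M} → (∀ {e} → e ∈ M → e ∈ E (H n)) → ∀ s → selected M (n , pullˡ s) ≡ false
selected-oob {n} {M} M⊆E s = dec-false (edge (n , pullˡ s) ∈? M) λ e∈ → go (∈-E⁻ {n} (M⊆E e∈))
  where
  go : ¬ ∃ λ q → InBoundsᵉ n q × edge (n , pullˡ s) ≡ edge q
  go (q , b , eq) = ℕ.<-irrefl refl (subst (InBoundsᵉ n) (sym (edge-injective {n , pullˡ s} {q} eq)) b)

word⇒perfect : ∀ {n f} → 0 < n → Legal f → isL (f n) ≡ false → wordMatching n f ∈ perfectMatchings (H n)
word⇒perfect {n} {f} 0<n legal last = balanced⇒perfect {n} {wordMatching n f} (filter∈subsets _ (E (H n))) balanced
  where
  agrees : ∀ {q} → InBoundsᵉ n q ⊎ (∃ λ s → q ≡ (n , pullˡ s)) → selected (wordMatching n f) q ≡ select f q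
  agrees {q} (inj₁ b)          = selected-matching {n} {select f} {q} 0<n b
  agrees     (inj₂ (s , refl)) = trans (selected-oob {n} (λ e∈ → proj₁ (∈-filter⁻ (λ e → T? (select f (decode e))) {xs = E (H n)} e∈)) s) (sym last)
  balanced : Balanced n (selected (wordMatching n f))
  balanced p b = trans (count-cong (All.map agrees (incidence-inBounds 0<n p b))) (select-balanced legal p)

perfect⇒word : ∀ {n M} → 0 < n → M ∈ perfectMatchings (H n) →
               ∃ λ f → Legal f × (∀ i → n ≤ i → f i ≡ filler) × M ≡ wordMatching n f
perfect⇒word {n} {M} 0<n M∈ =
  let f , legal , beyond , agrees = balanced⇒word (perfect⇒balanced {n} 0<n M∈) (selected-oob {n} (perfectMatching⊆E (H n) M∈))
  in f , legal , beyond ,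
     subsets-ext (E! (H n)) (proj₁ (∈-filter⁻ (perfect? (H n)) {xs = subsets (E (H n))} M∈)) (filter∈subsets _ (E (H n)))
       (λ e∈ → to f agrees e∈ (∈-E⁻ {n} (perfectMatching⊆E (H n) M∈ e∈)))
       (λ e∈ → from f agrees e∈ (∈-E⁻ {n} (proj₁ (∈-filter⁻ (λ e → T? (select f (decode e))) {xs = E (H n)} e∈))))
  where
  to : ∀ f → (∀ q → InBoundsᵉ n q → selected M q ≡ select f q) → ∀ {e} → e ∈ M →
       (∃ λ q → InBoundsᵉ n q × e ≡ edge q) → e ∈ wordMatching n f
  to f agrees e∈ (q , b , refl) =
    ∈-matching⁺ {n} {select f} {q} 0<n b (trans (sym (agrees q b)) (dec-true (edge q ∈? M) e∈))
  from : ∀ f → (∀ q → InBoundsᵉ n q → selected M q ≡ select f q) → ∀ {e} → e ∈ wordMatching n f →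
         (∃ λ q → InBoundsᵉ n q × e ≡ edge q) → e ∈ M
  from f agrees e∈ (q , b , refl) = selected⁻ {M} {q} (trans (agrees q b) (proj₂ (∈-matching⁻ {n} {select f} {q} e∈)))

letter-ext : ∀ {l l′} → isL l ≡ isL l′ → isR l ≡ isR l′ → (∀ s → inside l (ring s k0) ≡ inside l′ (ring s k0)) → l ≡ l′
letter-ext {L} {L} _ _ _ = refl
letter-ext {R} {R} _ _ _ = refl
letter-ext {hex x y} {hex x′ y′} _ _ eq = cong₂ hex (phase-ext (eq up)) (phase-ext (eq dn))
  where
  phase-ext : ∀ {x y} → on x k0 ≡ on y k0 → x ≡ y
  phase-ext {α} {α} _ = refl
  phase-ext {β} {β} _ = refl

wordMatching-injective : ∀ {n f g} → 0 < n → wordMatching n f ≡ wordMatching n g → ∀ i → i < n → f i ≡ g i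
wordMatching-injective {n} {f} {g} 0<n eq i i<n =
  letter-ext (same (i , pullˡ up) i<n) (same (i , pullʳ up) i<n) (λ s → same (i , ring s k0) i<n)
  where
  same : ∀ q → InBoundsᵉ n q → select f q ≡ select g q
  same q b = trans (sym (selected-matching {n} {select f} {q} 0<n b))
    (trans (cong (λ M → selected M q) eq) (selected-matching {n} {select g} {q} 0<n b))

at : List Letter → Word
at []      _       = filler
at (l ∷ w) zero    = l
at (l ∷ w) (suc i) = at w i

hexes : List Letter
hexes = hex α α ∷ hex β β ∷ hex α β ∷ hex β α ∷ []

letters : Bool → List Letter
letters false = L ∷ R ∷ hexes
letters true  = R ∷ hexes

-- afterR says that the letter before the word is R, which rules out an initial L.
words : Bool → ℕ → List (List Letter)
words afterR zero    = [] ∷ []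
words afterR (suc n) = concatMap (λ l → map (l ∷_) (words (isR l) n)) (letters afterR)

∈-letters⁺ : ∀ r l → r ∧ isL l ≡ false → l ∈ letters r
∈-letters⁺ false L         _ = here refl
∈-letters⁺ false R         _ = there (here refl)
∈-letters⁺ false (hex α α) _ = there (there (here refl))
∈-letters⁺ false (hex β β) _ = there (there (there (here refl)))
∈-letters⁺ false (hex α β) _ = there (there (there (there (here refl))))
∈-letters⁺ false (hex β α) _ = there (there (there (there (there (here refl)))))
∈-letters⁺ true  R         _ = here refl
∈-letters⁺ true  (hex α α) _ = there (here refl)
∈-letters⁺ true  (hex β β) _ = there (there (here refl))
∈-letters⁺ true  (hex α β) _ = there (there (there (here refl)))
∈-letters⁺ true  (hex β α) _ = there (there (there (there (here refl))))

∈-letters⁻ : ∀ r {l} → l ∈ letters r → r ∧ isL l ≡ false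
∈-letters⁻ false _ = refl
∈-letters⁻ true (here refl) = refl
∈-letters⁻ true (there (here refl)) = refl
∈-letters⁻ true (there (there (here refl))) = refl
∈-letters⁻ true (there (there (there (here refl)))) = refl
∈-letters⁻ true (there (there (there (there (here refl))))) = refl

letters-unique : ∀ r → Unique (letters r)
letters-unique true  = ((λ ()) ∷ (λ ()) ∷ (λ ()) ∷ (λ ()) ∷ []) ∷ ((λ ()) ∷ (λ ()) ∷ (λ ()) ∷ []) ∷
                       ((λ ()) ∷ (λ ()) ∷ []) ∷ ((λ ()) ∷ []) ∷ [] ∷ []
letters-unique false = ((λ ()) ∷ (λ ()) ∷ (λ ()) ∷ (λ ()) ∷ (λ ()) ∷ []) ∷ letters-unique true

words-unique : ∀ r n → Unique (words r n)
words-unique r zero    = [] ∷ []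
words-unique r (suc n) = go (letters-unique r)
  where
  step : Letter → List (List Letter)
  step l = map (l ∷_) (words (isR l) n)
  go : ∀ {ls} → Unique ls → Unique (concatMap step ls)
  go [] = []
  go {l ∷ ls} u@(_ ∷ ls!) = Unique.++⁺ (Unique.map⁺ ∷-injectiveʳ (words-unique (isR l) n)) (go ls!) disjoint
    where
    disjoint : ∀ {w} → ¬ (w ∈ step l × w ∈ concatMap step ls)
    disjoint (p , q) with _ , _ , refl ← ∈-map⁻ (l ∷_) p
      with l′ , l′∈ , r ← find (∈-concatMap⁻ step {xs = ls} q)
      with _ , _ , refl ← ∈-map⁻ (l′ ∷_) r = Unique.Unique[x∷xs]⇒x∉xs u l′∈

∈-words⁻ : ∀ r n {w} → w ∈ words r n → length w ≡ n × r ∧ isL (at w 0) ≡ false × Legal (at w)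
∈-words⁻ r zero (here refl) = refl , ∧-zeroʳ r , λ _ → refl
∈-words⁻ r (suc n) w∈ with l , l∈ , p ← find (∈-concatMap⁻ (λ l → map (l ∷_) (words (isR l) n)) {xs = letters r} w∈)
  with w , w∈′ , refl ← ∈-map⁻ (l ∷_) p
  with len , first , legal ← ∈-words⁻ (isR l) n w∈′ =
  cong suc len , ∈-letters⁻ r l∈ , λ { zero → first ; (suc i) → legal i }

∈-words⁺ : ∀ r n {f} → r ∧ isL (f 0) ≡ false → Legal f → applyUpTo f n ∈ words r n
∈-words⁺ r zero    _     _     = here refl
∈-words⁺ r (suc n) {f} first legal =
  ∈-concatMap⁺ (λ l → map (l ∷_) (words (isR l) n))
    (lose (∈-letters⁺ r (f 0) first) (∈-map⁺ (f 0 ∷_) (∈-words⁺ (isR (f 0)) n (legal 0) (legal ∘ suc))))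

at-applyUpTo : ∀ n {f} → (∀ i → n ≤ i → f i ≡ filler) → ∀ i → at (applyUpTo f n) i ≡ f i
at-applyUpTo zero    beyond i       = sym (beyond i z≤n)
at-applyUpTo (suc n) beyond zero    = refl
at-applyUpTo (suc n) beyond (suc i) = at-applyUpTo n (λ j n≤j → beyond (suc j) (s≤s n≤j)) i

at-beyond : ∀ w {i} → length w ≤ i → at w i ≡ filler
at-beyond []      _         = refl
at-beyond (l ∷ w) (s≤s w≤i) = at-beyond w w≤i

at-injective : ∀ w w′ → length w ≡ length w′ → (∀ i → i < length w → at w i ≡ at w′ i) → w ≡ w′
at-injective []      []       _   _  = refl
at-injective (l ∷ w) (l′ ∷ w′) len eq =
  cong₂ _∷_ (eq 0 (s≤s z≤n)) (at-injective w w′ (ℕ.suc-injective len) (λ i i<w → eq (suc i) (s≤s i<w)))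

select-cong : ∀ {f g} → (∀ i → f i ≡ g i) → ∀ q → select f q ≡ select g q
select-cong {f} {g} eq (zero  , vert) = cong (λ l → not (isL l)) (eq 0)
select-cong {f} {g} eq (suc i , vert) = cong₂ (λ l l′ → not (isR l) ∧ not (isL l′)) (eq i) (eq (suc i))
select-cong {f} {g} eq (i , e@link)       = cong (λ l → inside l e) (eq i)
select-cong {f} {g} eq (i , e@(ring _ _)) = cong (λ l → inside l e) (eq i)
select-cong {f} {g} eq (i , e@(pullˡ _))  = cong (λ l → inside l e) (eq i)
select-cong {f} {g} eq (i , e@(pullʳ _))  = cong (λ l → inside l e) (eq i)

wordMatching-cong : ∀ n {f g} → (∀ i → f i ≡ g i) → wordMatching n f ≡ wordMatching n g
wordMatching-cong n {f} {g} eq = filter-≐ _ _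
  ((λ {e} → subst T (select-cong eq (decode e))) , (λ {e} → subst T (sym (select-cong eq (decode e))))) (E (H n))

perfectMatchings↭words : ∀ n → 0 < n → perfectMatchings (H n) ↭ map (wordMatching n ∘ at) (words false n)
perfectMatchings↭words n 0<n = unique-set⇒↭ (perfectMatchings-unique (H n)) (map-unique (words-unique false n) (λ w∈ → w∈))
  (λ M∈ → to (perfect⇒word {n} 0<n M∈)) (λ M∈ → from (∈-map⁻ (wordMatching n ∘ at) M∈))
  where
  to : ∀ {M} → (∃ λ f → Legal f × (∀ i → n ≤ i → f i ≡ filler) × M ≡ wordMatching n f) →
       M ∈ map (wordMatching n ∘ at) (words false n)
  to (f , legal , beyond , refl) = subst (_∈ map (wordMatching n ∘ at) (words false n))
    (wordMatching-cong n (at-applyUpTo n beyond)) (∈-map⁺ (wordMatching n ∘ at) (∈-words⁺ false n refl legal))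
  from : ∀ {M} → (∃ λ w → w ∈ words false n × M ≡ wordMatching n (at w)) → M ∈ perfectMatchings (H n)
  from (w , w∈ , refl) = let len , _ , legal = ∈-words⁻ false n w∈ in
    word⇒perfect 0<n legal (cong isL (at-beyond w (ℕ.≤-reflexive len)))
  inj : ∀ {w w′} → w ∈ words false n → w′ ∈ words false n → wordMatching n (at w) ≡ wordMatching n (at w′) → w ≡ w′
  inj {w} {w′} w∈ w′∈ eq =
    let len , _ = ∈-words⁻ false n w∈ ; len′ , _ = ∈-words⁻ false n w′∈ in
    at-injective w w′ (trans len (sym len′))
      (λ i i<w → wordMatching-injective {n} 0<n eq i (subst (i <_) len i<w))
  map-unique : ∀ {ws} → Unique ws → (∀ {w} → w ∈ ws → w ∈ words false n) → Unique (map (wordMatching n ∘ at) ws)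
  map-unique [] _ = []
  map-unique {w ∷ ws} (w∉ ∷ ws!) sub =
    All.tabulate (λ M∈ → fresh (∈-map⁻ (wordMatching n ∘ at) M∈)) ∷ map-unique ws! (sub ∘ there)
    where
    fresh : ∀ {M} → (∃ λ w′ → w′ ∈ ws × M ≡ wordMatching n (at w′)) → wordMatching n (at w) ≢ M
    fresh (w′ , w′∈ , refl) eq = All.lookup w∉ w′∈ (inj (sub (here refl)) (sub (there w′∈)) eq)

-- The anti-forcing number of a word

data Tag : Set where
  t0 t1 t2 : Tag

Label : Set
Label = ℕ × Tag

tags : Letter → List Tag
tags (hex α α) = t0 ∷ t1 ∷ t2 ∷ []
tags (hex β β) = t0 ∷ t1 ∷ t2 ∷ []
tags (hex α β) = t0 ∷ t1 ∷ []
tags (hex β α) = t0 ∷ t1 ∷ []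
tags L         = t0 ∷ []
tags R         = t0 ∷ []

weight : List Letter → ℕ
weight []      = 0
weight (l ∷ w) = length (tags l) + weight w

labels : ℕ → List Letter → List Label
labels j []      = []
labels j (l ∷ w) = map (j ,_) (tags l) ++ labels (suc j) w

length-labels : ∀ j w → length (labels j w) ≡ weight w
length-labels j []      = refl
length-labels j (l ∷ w) = trans (length-++ (map (j ,_) (tags l)))
  (cong₂ _+_ (length-map (j ,_) (tags l)) (length-labels (suc j) w))

∈-labels⁻ : ∀ j w {x} → x ∈ labels j w → ∃ λ i → i < length w × ∃ λ t → t ∈ tags (at w i) × x ≡ (i + j , t)
∈-labels⁻ j (l ∷ w) x∈ with ∈-++⁻ (map (j ,_) (tags l)) x∈
... | inj₁ x∈l with t , t∈ , refl ← ∈-map⁻ (j ,_) x∈l = 0 , s≤s z≤n , t , t∈ , refl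
... | inj₂ x∈w with i , i<w , t , t∈ , refl ← ∈-labels⁻ (suc j) w x∈w =
  suc i , s≤s i<w , t , t∈ , cong (_, t) (ℕ.+-suc i j)

tags-unique : ∀ l → Unique (tags l)
tags-unique (hex α α) = ((λ ()) ∷ (λ ()) ∷ []) ∷ ((λ ()) ∷ []) ∷ [] ∷ []
tags-unique (hex β β) = ((λ ()) ∷ (λ ()) ∷ []) ∷ ((λ ()) ∷ []) ∷ [] ∷ []
tags-unique (hex α β) = ((λ ()) ∷ []) ∷ [] ∷ []
tags-unique (hex β α) = ((λ ()) ∷ []) ∷ [] ∷ []
tags-unique L = [] ∷ []
tags-unique R = [] ∷ []

labels-unique : ∀ j w → Unique (labels j w)
labels-unique j []      = []
labels-unique j (l ∷ w) = Unique.++⁺ (Unique.map⁺ ,-injectiveʳ (tags-unique l)) (labels-unique (suc j) w) disjoint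
  where
  disjoint : ∀ {x} → ¬ (x ∈ map (j ,_) (tags l) × x ∈ labels (suc j) w)
  disjoint (p , q) with _ , _ , refl ← ∈-map⁻ (j ,_) p with i , _ , _ , _ , eq ← ∈-labels⁻ (suc j) w q =
    ℕ.<-irrefl (cong proj₁ eq) (ℕ.m≤n+m (suc j) i)

ownerᴸ : Letter → ℕ → EName → Label
ownerᴸ (hex _ _) i vert        = i , t0
ownerᴸ (hex _ _) i (ring up _) = suc i , t0
ownerᴸ (hex _ _) i (ring dn _) = suc i , t1
ownerᴸ (hex _ _) i _           = suc i , t2
ownerᴸ L         i (ring _ k0) = i , t2
ownerᴸ L         i _           = suc i , t0
ownerᴸ R         i (ring _ k5) = suc (suc i) , t2
ownerᴸ R         i vert        = i , t0
ownerᴸ R         i _           = suc i , t0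

-- Letter i carries the labels (suc i , _).  There are as many labels as the
-- weight of the word, and the edges outside the matching are shared out among
-- them in such a way that for every label there is another perfect matching
-- all of whose new edges belong to that label.
owner : Word → ERef → Label
owner f (i , e) = ownerᴸ (f i) i e

replace : Word → ℕ → Letter → Letter → Word
replace f i l l′ j with j ≟ i | j ≟ suc i
... | yes _ | _     = l
... | no  _ | yes _ = l′
... | no  _ | no  _ = f j

module _ (f : Word) (i : ℕ) (l l′ : Letter) where

  replace-0 : replace f i l l′ i ≡ l
  replace-0 with i ≟ i
  ... | yes _  = refl
  ... | no i≢i = contradiction refl i≢i

  replace-1 : replace f i l l′ (suc i) ≡ l′
  replace-1 with suc i ≟ i | suc i ≟ suc i
  ... | yes eq | _     = contradiction eq ℕ.1+n≢n
  ... | no _   | yes _ = refl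
  ... | no _   | no ≢  = contradiction refl ≢

  replace-else : ∀ {j} → j ≢ i → j ≢ suc i → replace f i l l′ j ≡ f j
  replace-else {j} ≢i ≢1+i with j ≟ i | j ≟ suc i
  ... | yes eq | _      = contradiction eq ≢i
  ... | no _   | yes eq = contradiction eq ≢1+i
  ... | no _   | no _   = refl

data Near (i : ℕ) : ℕ → Set where
  near0 : Near i i
  near1 : Near i (suc i)
  near2 : Near i (suc (suc i))
  far   : ∀ {j} → j ≢ i → j ≢ suc i → j ≢ suc (suc i) → Near i j

near : ∀ i j → Near i j
near i j with j ≟ i | j ≟ suc i | j ≟ suc (suc i)
... | yes refl | _        | _        = near0
... | no _     | yes refl | _        = near1
... | no _     | no _     | yes refl = near2
... | no ≢0    | no ≢1    | no ≢2    = far ≢0 ≢1 ≢2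

Alternative : ℕ → Word → Label → Set
Alternative n f x = ∃ λ g → Legal g × isL (g n) ≡ false × (∃ λ i → i < n × g i ≢ f i) ×
                    (∀ q → select g q ≡ true → select f q ≡ false → owner f q ≡ x)

New : Bool → Bool → Set
New x y = x ≡ true × y ≡ false

¬new : ∀ {A : Set} {x y} → x ≡ y → New x y → A
¬new refl (refl , ())

alternative : ∀ {n f} → Legal f → isL (f n) ≡ false → ∀ i {c c′} l l′ {x} → f i ≡ c → f (suc i) ≡ c′ → i < n → l ≢ c →
  prevR f i ∧ isL l ≡ false → isR l ∧ isL l′ ≡ false → isR l′ ∧ isL (f (suc (suc i))) ≡ false →
  (suc i ≡ n → isL l′ ≡ false) →
  (∀ e → New (inside l e) (inside c e) → ownerᴸ c i e ≡ x) →
  (∀ e → New (inside l′ e) (inside c′ e) → ownerᴸ c′ (suc i) e ≡ x) →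
  (New (not (prevR f i) ∧ not (isL l)) (not (prevR f i) ∧ not (isL c)) → ownerᴸ c i vert ≡ x) →
  (New (not (isR l) ∧ not (isL l′)) (not (isR c) ∧ not (isL c′)) → ownerᴸ c′ (suc i) vert ≡ x) →
  isR l′ ≡ isR c′ →
  Alternative n f x
alternative {n} {f} legal last i l l′ {x} refl refl i<n l≢ leg₀ leg₁ leg₂ last′ new₀ new₁ vert₀ vert₁ vert₂ =
  g , legal′ , last″ , (i , i<n , λ eq → l≢ (trans (sym g0) eq)) , owned
  where
  g : Word
  g = replace f i l l′
  g0 : g i ≡ l
  g0 = replace-0 f i l l′
  g1 : g (suc i) ≡ l′
  g1 = replace-1 f i l l′

  prev-0 : ∀ i {l l′} → prevR (replace f i l l′) i ≡ prevR f i
  prev-0 zero = refl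
  prev-0 (suc i) {l} {l′} = cong isR (replace-else f (suc i) l l′ (ℕ.<⇒≢ (ℕ.n<1+n i)) (ℕ.<⇒≢ (ℕ.<-trans (ℕ.n<1+n i) (ℕ.n<1+n (suc i)))))

  g2 : g (suc (suc i)) ≡ f (suc (suc i))
  g2 = replace-else f i l l′ (ℕ.>⇒≢ (ℕ.<-trans (ℕ.n<1+n i) (ℕ.n<1+n (suc i)))) ℕ.1+n≢n

  prev-else : ∀ {j} → j ≢ suc i → j ≢ suc (suc i) → prevR g j ≡ prevR f j
  prev-else {zero}  _  _  = refl
  prev-else {suc j} ≢1 ≢2 = cong isR (replace-else f i l l′ (≢1 ∘ cong suc) (≢2 ∘ cong suc))

  legal-at : ∀ j → prevR f j ∧ isL (f j) ≡ false
  legal-at zero    = refl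
  legal-at (suc j) = legal j

  legal″ : ∀ j → prevR g j ∧ isL (g j) ≡ false
  legal″ j with near i j
  ... | near0 = trans (cong₂ (λ r l → r ∧ isL l) (prev-0 i) g0) leg₀
  ... | near1 = trans (cong₂ (λ l l′ → isR l ∧ isL l′) g0 g1) leg₁
  ... | near2 = trans (cong₂ (λ l l′ → isR l ∧ isL l′) g1 g2) leg₂
  ... | far ≢0 ≢1 ≢2 = trans (cong₂ (λ r l → r ∧ isL l) (prev-else ≢1 ≢2) (replace-else f i l l′ ≢0 ≢1)) (legal-at j)

  legal′ : Legal g
  legal′ j = legal″ (suc j)

  last″ : isL (g n) ≡ false
  last″ with near i n
  ... | near0 = contradiction i<n (ℕ.<-irrefl refl)
  ... | near1 = trans (cong isL g1) (last′ refl)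
  ... | near2 = trans (cong isL g2) last
  ... | far ≢0 ≢1 _ = trans (cong isL (replace-else f i l l′ ≢0 ≢1)) last

  inner : ∀ j e → New (inside (g j) e) (inside (f j) e) → ownerᴸ (f j) j e ≡ x
  inner j e new with near i j
  ... | near0 = new₀ e (subst (λ l → New (inside l e) (inside (f i) e)) g0 new)
  ... | near1 = new₁ e (subst (λ l → New (inside l e) (inside (f (suc i)) e)) g1 new)
  ... | near2 = ¬new (cong (λ l → inside l e) g2) new
  ... | far ≢0 ≢1 _ = ¬new (cong (λ l → inside l e) (replace-else f i l l′ ≢0 ≢1)) new

  outer : ∀ j → New (select g (j , vert)) (select f (j , vert)) → owner f (j , vert) ≡ x
  outer j new with near i j
  ... | near0 = vert₀ (subst₂ (λ r l → New (not r ∧ not (isL l)) _) (prev-0 i) g0 new)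
  ... | near1 = vert₁ (subst₂ (λ l l′ → New (not (isR l) ∧ not (isL l′)) _) g0 g1 new)
  ... | near2 = ¬new (cong₂ (λ r l → not r ∧ not (isL l)) (trans (cong isR g1) vert₂) g2) new
  ... | far ≢0 ≢1 ≢2 = ¬new (cong₂ (λ r l → not r ∧ not (isL l)) (prev-else ≢1 ≢2) (replace-else f i l l′ ≢0 ≢1)) new

  owned : ∀ q → select g q ≡ true → select f q ≡ false → owner f q ≡ x
  owned (j , vert)       p r = outer j (p , r)
  owned (j , e@link)       p r = inner j e (p , r)
  owned (j , e@(ring _ _)) p r = inner j e (p , r)
  owned (j , e@(pullˡ _))  p r = inner j e (p , r)
  owned (j , e@(pullʳ _))  p r = inner j e (p , r)

isR⇒≡ : ∀ {l} → isR l ≡ true → l ≡ R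
isR⇒≡ {R} _ = refl

isL⇒≡ : ∀ {l} → isL l ≡ true → l ≡ L
isL⇒≡ {L} _ = refl

flip : Phase → Phase
flip α = β
flip β = α

flip≢ : ∀ {x} → flip x ≢ x
flip≢ {α} ()
flip≢ {β} ()

new-ring : ∀ x s {k y} → New (on (phase x x s) k) y → New (on x k) y
new-ring x up new = new
new-ring x dn new = new

ring-new : ∀ x s {k y} → New y (on (phase x x s) k) → New y (on x k)
ring-new x up new = new
ring-new x dn new = new

vert-owner : ∀ c {i} → isL c ≡ false → ownerᴸ c i vert ≡ (i , t0)
vert-owner (hex _ _) _ = refl
vert-owner R         _ = refl

module _ {n f} (legal : Legal f) (last : isL (f n) ≡ false) where

  alternative₁ : ∀ i {c} l {x} → f i ≡ c → i < n → l ≢ c →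
    prevR f i ∧ isL l ≡ false → isR l ∧ isL (f (suc i)) ≡ false →
    (∀ e → New (inside l e) (inside c e) → ownerᴸ c i e ≡ x) →
    (New (not (prevR f i) ∧ not (isL l)) (not (prevR f i) ∧ not (isL c)) → ownerᴸ c i vert ≡ x) →
    (New (not (isR l) ∧ not (isL (f (suc i)))) (not (isR c) ∧ not (isL (f (suc i)))) → ownerᴸ (f (suc i)) (suc i) vert ≡ x) →
    Alternative n f x
  alternative₁ i l eq i<n l≢ leg₀ leg₁ new₀ vert₀ vert₁ =
    alternative legal last i l (f (suc i)) eq refl i<n l≢ leg₀ leg₁ (legal (suc i))
      (λ { refl → last }) new₀ (λ _ → ¬new refl) vert₀ vert₁ refl

  flip-up : ∀ i {x y} → f i ≡ hex x y → i < n → Alternative n f (suc i , t0)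
  flip-up i {x} {y} eq i<n = alternative₁ i (hex (flip x) y) eq i<n (λ eq′ → flip≢ (cong fst eq′))
    (∧-zeroʳ _) refl new (¬new refl) (¬new refl)
    where
    fst : Letter → Phase
    fst (hex x _) = x
    fst _         = α
    new : ∀ e → New (inside (hex (flip x) y) e) (inside (hex x y) e) → ownerᴸ (hex x y) i e ≡ (suc i , t0)
    new vert        = ¬new refl
    new link        = ¬new refl
    new (ring up _) = λ _ → refl
    new (ring dn _) = ¬new refl
    new (pullˡ _)   = ¬new refl
    new (pullʳ _)   = ¬new refl

  flip-dn : ∀ i {x y} → f i ≡ hex x y → i < n → Alternative n f (suc i , t1)
  flip-dn i {x} {y} eq i<n = alternative₁ i (hex x (flip y)) eq i<n (λ eq′ → flip≢ (cong snd eq′))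
    (∧-zeroʳ _) refl new (¬new refl) (¬new refl)
    where
    snd : Letter → Phase
    snd (hex _ y) = y
    snd _         = α
    new : ∀ e → New (inside (hex x (flip y)) e) (inside (hex x y) e) → ownerᴸ (hex x y) i e ≡ (suc i , t1)
    new vert        = ¬new refl
    new link        = ¬new refl
    new (ring up _) = ¬new refl
    new (ring dn _) = λ _ → refl
    new (pullˡ _)   = ¬new refl
    new (pullʳ _)   = ¬new refl

  R→αα : ∀ i → f i ≡ R → i < n → Alternative n f (suc i , t0)
  R→αα i eq i<n = alternative₁ i (hex α α) eq i<n (λ ()) (∧-zeroʳ _) refl new (¬new refl)
    (λ _ → vert-owner (f (suc i)) (subst (λ l → isR l ∧ isL (f (suc i)) ≡ false) eq (legal i)))
    where
    ring-case : ∀ s k → New (on α k) (onR k) → ownerᴸ R i (ring s k) ≡ (suc i , t0)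
    ring-case s k0 _ = refl
    ring-case s k1 (() , _)
    ring-case s k2 _ = refl
    ring-case s k3 (() , _)
    ring-case s k4 _ = refl
    ring-case s k5 (() , _)
    new : ∀ e → New (inside (hex α α) e) (inside R e) → ownerᴸ R i e ≡ (suc i , t0)
    new vert       (() , _)
    new link       (() , _)
    new (ring s k) p = ring-case s k (new-ring α s p)
    new (pullˡ _)  (() , _)
    new (pullʳ _)  (() , _)

  L→ββ : ∀ i → f i ≡ L → i < n → Alternative n f (suc i , t0)
  L→ββ i eq i<n = alternative₁ i (hex β β) eq i<n (λ ()) (∧-zeroʳ _) refl new (λ _ → refl) (¬new refl)
    where
    ring-case : ∀ s k → New (on β k) (onL k) → ownerᴸ L i (ring s k) ≡ (suc i , t0)
    ring-case s k0 (() , _)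
    ring-case s k1 _ = refl
    ring-case s k2 (() , _)
    ring-case s k3 _ = refl
    ring-case s k4 (() , _)
    ring-case s k5 _ = refl
    new : ∀ e → New (inside (hex β β) e) (inside L e) → ownerᴸ L i e ≡ (suc i , t0)
    new vert       (() , _)
    new link       (() , _)
    new (ring s k) p = ring-case s k (new-ring β s p)
    new (pullˡ _)  (() , _)
    new (pullʳ _)  (() , _)

  αα→L-new : ∀ i e → New (inside L e) (inside (hex α α) e) → ownerᴸ (hex α α) i e ≡ (suc i , t2)
  αα→L-new i link       _ = refl
  αα→L-new i (pullˡ _)  _ = refl
  αα→L-new i vert       (() , _)
  αα→L-new i (pullʳ _)  (() , _)
  αα→L-new i (ring s k) p = ring-case k (ring-new α s p)
    where
    ring-case : ∀ k → New (onL k) (on α k) → ownerᴸ (hex α α) i (ring s k) ≡ (suc i , t2)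
    ring-case k0 (() , _)
    ring-case k1 (() , _)
    ring-case k2 (_ , ())
    ring-case k3 (() , _)
    ring-case k4 (_ , ())
    ring-case k5 (() , _)

  ββ→R-new : ∀ i e → New (inside R e) (inside (hex β β) e) → ownerᴸ (hex β β) i e ≡ (suc i , t2)
  ββ→R-new i link       _ = refl
  ββ→R-new i (pullʳ _)  _ = refl
  ββ→R-new i vert       (() , _)
  ββ→R-new i (pullˡ _)  (() , _)
  ββ→R-new i (ring s k) p = ring-case k (ring-new β s p)
    where
    ring-case : ∀ k → New (onR k) (on β k) → ownerᴸ (hex β β) i (ring s k) ≡ (suc i , t2)
    ring-case k0 (() , _)
    ring-case k1 (_ , ())
    ring-case k2 (() , _)
    ring-case k3 (_ , ())
    ring-case k4 (() , _)
    ring-case k5 (() , _)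

  αα→L : ∀ i → f i ≡ hex α α → i < n → prevR f i ≡ false → Alternative n f (suc i , t2)
  αα→L i eq i<n prev = alternative₁ i L eq i<n (λ ()) (cong (_∧ true) prev) refl (αα→L-new i)
    (λ (p , _) → contradiction (trans (sym p) (∧-zeroʳ _)) λ ()) (¬new refl)

  Rαα→ββL : ∀ i → f i ≡ R → f (suc i) ≡ hex α α → suc i < n → Alternative n f (suc (suc i) , t2)
  Rαα→ββL i eq eq′ 1+i<n = alternative legal last i (hex β β) L eq eq′ (ℕ.<-trans (ℕ.n<1+n i) 1+i<n) (λ ())
    (∧-zeroʳ _) refl refl (λ { refl → contradiction 1+i<n (ℕ.<-irrefl refl) }) new (αα→L-new (suc i))
    (¬new refl) (λ { (() , _) }) refl
    where
    ring-case : ∀ s k → New (on β k) (onR k) → ownerᴸ R i (ring s k) ≡ (suc (suc i) , t2)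
    ring-case s k0 (() , _)
    ring-case s k1 (_ , ())
    ring-case s k2 (() , _)
    ring-case s k3 (_ , ())
    ring-case s k4 (() , _)
    ring-case s k5 _ = refl
    new : ∀ e → New (inside (hex β β) e) (inside R e) → ownerᴸ R i e ≡ (suc (suc i) , t2)
    new vert       (() , _)
    new link       (() , _)
    new (ring s k) p = ring-case s k (new-ring β s p)
    new (pullˡ _)  (() , _)
    new (pullʳ _)  (() , _)

  ββ→R : ∀ i → f i ≡ hex β β → i < n → isL (f (suc i)) ≡ false → Alternative n f (suc i , t2)
  ββ→R i eq i<n next = alternative₁ i R eq i<n (λ ()) (∧-zeroʳ _) next (ββ→R-new i) (¬new refl) (λ { (() , _) })

  ββL→Rαα : ∀ i → f i ≡ hex β β → f (suc i) ≡ L → i < n → Alternative n f (suc i , t2)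
  ββL→Rαα i eq eq′ i<n = alternative legal last i R (hex α α) eq eq′ i<n (λ ())
    (∧-zeroʳ _) refl refl (λ _ → refl) (ββ→R-new i) new (¬new refl) (λ { (() , _) }) refl
    where
    ring-case : ∀ s k → New (on α k) (onL k) → ownerᴸ L (suc i) (ring s k) ≡ (suc i , t2)
    ring-case s k0 _ = refl
    ring-case s k1 (() , _)
    ring-case s k2 (_ , ())
    ring-case s k3 (() , _)
    ring-case s k4 (_ , ())
    ring-case s k5 (() , _)
    new : ∀ e → New (inside (hex α α) e) (inside L e) → ownerᴸ L (suc i) e ≡ (suc i , t2)
    new vert       (() , _)
    new link       (() , _)
    new (ring s k) p = ring-case s k (new-ring α s p)
    new (pullˡ _)  (() , _)
    new (pullʳ _)  (() , _)

  third-α : ∀ i → f i ≡ hex α α → i < n → Alternative n f (suc i , t2)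
  third-α zero    eq i<n = αα→L 0 eq i<n refl
  third-α (suc i) eq i<n with isR (f i) in r
  ... | false = αα→L (suc i) eq i<n r
  ... | true  = Rαα→ββL i (isR⇒≡ r) eq i<n

  third-β : ∀ i → f i ≡ hex β β → i < n → Alternative n f (suc i , t2)
  third-β i eq i<n with isL (f (suc i)) in l
  ... | false = ββ→R i eq i<n l
  ... | true  = ββL→Rαα i eq (isL⇒≡ l) i<n

  alternatives : ∀ i → i < n → ∀ {t} → t ∈ tags (f i) → Alternative n f (suc i , t)
  alternatives i i<n t∈ = go (f i) refl t∈
    where
    go : ∀ c → f i ≡ c → ∀ {t} → t ∈ tags c → Alternative n f (suc i , t)
    go (hex α α) eq (here refl)                 = flip-up i eq i<n
    go (hex α α) eq (there (here refl))         = flip-dn i eq i<n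
    go (hex α α) eq (there (there (here refl))) = third-α i eq i<n
    go (hex β β) eq (here refl)                 = flip-up i eq i<n
    go (hex β β) eq (there (here refl))         = flip-dn i eq i<n
    go (hex β β) eq (there (there (here refl))) = third-β i eq i<n
    go (hex α β) eq (here refl)                 = flip-up i eq i<n
    go (hex α β) eq (there (here refl))         = flip-dn i eq i<n
    go (hex β α) eq (here refl)                 = flip-up i eq i<n
    go (hex β α) eq (there (here refl))         = flip-dn i eq i<n
    go L         eq (here refl)                 = L→ββ i eq i<n
    go R         eq (here refl)                 = R→αα i eq i<n

af-lower : ∀ {n w} → 0 < n → length w ≡ n → Legal (at w) → ∀ {S} →
           S ∈ antiForcingSets (H n) (wordMatching n (at w)) → weight w ≤ length S
af-lower {n} {w} 0<n len legal {S} S∈ =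
  subst₂ _≤_ (length-labels 1 w) (length-map (owner f ∘ decode) S) (unique-⊆⇒length≤ (labels-unique 1 w) (λ x∈ → label (∈-labels⁻ 1 w x∈)))
  where
  f : Word
  f = at w
  last : isL (f n) ≡ false
  last = cong isL (at-beyond w (ℕ.≤-reflexive len))
  owned : ∀ {g x e} → (∀ q → select g q ≡ true → select f q ≡ false → owner f q ≡ x) → e ∈ S →
          e ∈ wordMatching n g → e ∉ wordMatching n f → (∃ λ q → InBoundsᵉ n q × e ≡ edge q) → x ∈ map (owner f ∘ decode) S
  owned {g} {x} own e∈S e∈g e∉f (q , b , refl) = subst (_∈ map (owner f ∘ decode) S)
    (trans (cong (owner f) (decode-edge q)) (own q (proj₂ (∈-matching⁻ {n} {select g} {q} e∈g)) (¬-not (e∉f ∘ ∈-matching⁺ {n} {select f} {q} 0<n b))))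
    (∈-map⁺ (owner f ∘ decode) e∈S)
  hit : ∀ {x} → Alternative n f x → x ∈ map (owner f ∘ decode) S
  hit (g , legal′ , last′ , (i , i<n , g≢f) , own) =
    let g∈ = word⇒perfect {n} {g} 0<n legal′ last′
        e , e∈S , e∈g , e∉f = antiForcing-hits {H n} {S} {wordMatching n f} {wordMatching n g} S∈ g∈
          (λ eq → g≢f (wordMatching-injective {n} {g} {f} 0<n eq i i<n))
    in owned {g} own e∈S e∈g e∉f (∈-E⁻ {n} (perfectMatching⊆E (H n) g∈ e∈g))
  label : ∀ {x} → (∃ λ i → i < length w × ∃ λ t → t ∈ tags (f i) × x ≡ (i + 1 , t)) → x ∈ map (owner f ∘ decode) S
  label (i , i<w , t , t∈ , refl) =
    subst (λ j → (j , t) ∈ map (owner f ∘ decode) S) (ℕ.+-comm 1 i) (hit (alternatives legal last i (subst (i <_) len i<w) t∈))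

forced : Letter → ℕ → List ERef
forced (hex α α) i = (i , link) ∷ (i , ring up k1) ∷ (i , ring dn k1) ∷ []
forced (hex β β) i = (i , link) ∷ (i , ring up k0) ∷ (i , ring dn k0) ∷ []
forced (hex α β) i = (i , ring up k3) ∷ (i , ring dn k2) ∷ []
forced (hex β α) i = (i , ring up k2) ∷ (i , ring dn k3) ∷ []
forced L         i = (i , vert) ∷ []
forced R         i = (suc i , vert) ∷ []

forcedWord : ℕ → List Letter → List ERef
forcedWord j []      = []
forcedWord j (l ∷ w) = forced l j ++ forcedWord (suc j) w

length-forced : ∀ l i → length (forced l i) ≡ length (tags l)
length-forced (hex α α) i = refl
length-forced (hex β β) i = refl
length-forced (hex α β) i = refl
length-forced (hex β α) i = refl
length-forced L         i = refl
length-forced R         i = refl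

length-forcedWord : ∀ j w → length (forcedWord j w) ≡ weight w
length-forcedWord j []      = refl
length-forcedWord j (l ∷ w) = trans (length-++ (forced l j)) (cong₂ _+_ (length-forced l j) (length-forcedWord (suc j) w))

∈-forcedWord⁺ : ∀ j w {i q} → i < length w → q ∈ forced (at w i) (j + i) → q ∈ forcedWord j w
∈-forcedWord⁺ j (l ∷ w) {zero}  {q} _         q∈ = ∈-++⁺ˡ (subst (λ i → q ∈ forced l i) (ℕ.+-identityʳ j) q∈)
∈-forcedWord⁺ j (l ∷ w) {suc i} {q} (s≤s i<w) q∈ =
  ∈-++⁺ʳ (forced l j) (∈-forcedWord⁺ (suc j) w i<w (subst (λ m → q ∈ forced (at w i) m) (ℕ.+-suc j i) q∈))

∈-forcedWord⁻ : ∀ j w {q} → q ∈ forcedWord j w → ∃ λ i → q ∈ forced (at w i) (j + i)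
∈-forcedWord⁻ j (l ∷ w) {q} q∈ with ∈-++⁻ (forced l j) q∈
... | inj₁ q∈l = 0 , subst (λ i → q ∈ forced l i) (sym (ℕ.+-identityʳ j)) q∈l
... | inj₂ q∈w with i , q∈i ← ∈-forcedWord⁻ (suc j) w q∈w =
  suc i , subst (λ m → q ∈ forced (at w i) m) (sym (ℕ.+-suc j i)) q∈i

forced-inBounds : ∀ {n i} l → i < n → All (InBoundsᵉ n) (forced l i)
forced-inBounds (hex α α) i<n = i<n ∷ i<n ∷ i<n ∷ []
forced-inBounds (hex β β) i<n = i<n ∷ i<n ∷ i<n ∷ []
forced-inBounds (hex α β) i<n = i<n ∷ i<n ∷ []
forced-inBounds (hex β α) i<n = i<n ∷ i<n ∷ []
forced-inBounds L         i<n = ℕ.<⇒≤ i<n ∷ []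
forced-inBounds R         i<n = i<n ∷ []

Avoids : Word → List ERef → Set
Avoids f = All (λ q → select f q ≡ false)

avoids-forced : ∀ f i → Avoids f (forced (f i) i)
avoids-forced f i = go (f i) refl
  where
  is : ∀ {c} e → f i ≡ c → inside c e ≡ false → inside (f i) e ≡ false
  is e eq = subst (λ l → inside l e ≡ false) (sym eq)
  go : ∀ c → f i ≡ c → Avoids f (forced c i)
  go (hex α α) eq = is link eq refl ∷ is (ring up k1) eq refl ∷ is (ring dn k1) eq refl ∷ []
  go (hex β β) eq = is link eq refl ∷ is (ring up k0) eq refl ∷ is (ring dn k0) eq refl ∷ []
  go (hex α β) eq = is (ring up k3) eq refl ∷ is (ring dn k2) eq refl ∷ []
  go (hex β α) eq = is (ring up k2) eq refl ∷ is (ring dn k3) eq refl ∷ []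
  go L         eq = trans (cong (λ l → not (prevR f i) ∧ not (isL l)) eq) (∧-zeroʳ _) ∷ []
  go R         eq = cong (λ l → not (isR l) ∧ not (isL (f (suc i)))) eq ∷ []

avoids-hex : ∀ g i x y → Avoids g (forced (hex x y) i) → g i ≡ hex x y
avoids-hex g i α α (p ∷ q ∷ r ∷ []) = fix (g i) p q r
  where
  fix : ∀ l → inside l link ≡ false → inside l (ring up k1) ≡ false → inside l (ring dn k1) ≡ false → l ≡ hex α α
  fix (hex α α) _ _ _ = refl
avoids-hex g i β β (p ∷ q ∷ r ∷ []) = fix (g i) p q r
  where
  fix : ∀ l → inside l link ≡ false → inside l (ring up k0) ≡ false → inside l (ring dn k0) ≡ false → l ≡ hex β β
  fix (hex β β) _ _ _ = refl
avoids-hex g i α β (p ∷ q ∷ []) = fix (g i) p q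
  where
  fix : ∀ l → inside l (ring up k3) ≡ false → inside l (ring dn k2) ≡ false → l ≡ hex α β
  fix (hex α β) _ _ = refl
avoids-hex g i β α (p ∷ q ∷ []) = fix (g i) p q
  where
  fix : ∀ l → inside l (ring up k2) ≡ false → inside l (ring dn k3) ≡ false → l ≡ hex β α
  fix (hex β α) _ _ = refl

-- Deleting the forced edges of the hex letters fixes those letters one by one.
-- Given that, the letters R are fixed from right to left, because a deleted
-- vertical side must be covered from the left or from the right, and then the
-- letters L from left to right.
module _ {n f g} (legal : Legal f) (last : isL (g n) ≡ false)
         (avoids : ∀ i → i < n → Avoids g (forced (f i) i)) where

  private
    avoids-≡ : ∀ i {c} → f i ≡ c → i < n → Avoids g (forced c i)
    avoids-≡ i eq i<n = subst (λ l → Avoids g (forced l i)) eq (avoids i i<n)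

    forced-hex : ∀ i {x y} → f i ≡ hex x y → i < n → g i ≡ hex x y
    forced-hex i {x} {y} eq i<n = avoids-hex g i x y (avoids-≡ i eq i<n)

    pulled : ∀ r l → not r ∧ not l ≡ false → l ≡ false → r ≡ true
    pulled true false _ _ = refl

    pulled′ : ∀ r l → not r ∧ not l ≡ false → r ≡ false → l ≡ true
    pulled′ false true _ _ = refl

    forced-R : ∀ d i → suc (d + i) ≡ n → f i ≡ R → g i ≡ R
    forced-R d i i+d≡n eq = isR⇒≡ (pulled _ _ (All.head (avoids-≡ i eq i<n)) (next d i+d≡n))
      where
      i<n : i < n
      i<n = subst (i <_) i+d≡n (s≤s (ℕ.m≤n+m i d))
      next : ∀ d → suc (d + i) ≡ n → isL (g (suc i)) ≡ false
      next zero    refl = last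
      next (suc d) eq′ = go (f (suc i)) refl
        where
        eq″ : suc (d + suc i) ≡ n
        eq″ = trans (cong suc (ℕ.+-suc d i)) eq′
        1+i<n : suc i < n
        1+i<n = subst (suc i <_) eq″ (s≤s (ℕ.m≤n+m (suc i) d))
        go : ∀ c → f (suc i) ≡ c → isL (g (suc i)) ≡ false
        go (hex x y) next≡ = cong isL (forced-hex (suc i) next≡ 1+i<n)
        go R         next≡ = cong isL (forced-R d (suc i) eq″ next≡)
        go L         next≡ = contradiction (trans (sym (cong₂ (λ l l′ → isR l ∧ isL l′) eq next≡)) (legal i)) λ ()

    forced-L : ∀ i → i < n → f i ≡ L → g i ≡ L
    forced-L i i<n eq = isL⇒≡ (pulled′ _ _ (All.head (avoids-≡ i eq i<n)) (prev i i<n eq))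
      where
      prev : ∀ i → i < n → f i ≡ L → prevR g i ≡ false
      prev zero    _   _  = refl
      prev (suc i) i<n eq = go (f i) refl
        where
        i<n′ : i < n
        i<n′ = ℕ.<-trans (ℕ.n<1+n i) i<n
        go : ∀ c → f i ≡ c → isR (g i) ≡ false
        go (hex x y) prev≡ = cong isR (forced-hex i prev≡ i<n′)
        go L         prev≡ = cong isR (forced-L i i<n′ prev≡)
        go R         prev≡ = contradiction (trans (sym (cong₂ (λ l l′ → isR l ∧ isL l′) prev≡ eq)) (legal i)) λ ()

  forced-unique : ∀ i → i < n → g i ≡ f i
  forced-unique i i<n = go (f i) refl
    where
    go : ∀ c → f i ≡ c → g i ≡ f i
    go (hex x y) eq = trans (forced-hex i eq i<n) (sym eq)
    go L         eq = trans (forced-L i i<n eq) (sym eq)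
    go R         eq = trans (forced-R (n ∸ suc i) i (trans (sym (ℕ.+-suc (n ∸ suc i) i)) (ℕ.m∸n+n≡m i<n)) eq) (sym eq)

af-upper : ∀ {n w} → 0 < n → length w ≡ n → Legal (at w) →
           ∃ λ S → S ∈ antiForcingSets (H n) (wordMatching n (at w)) × length S ≤ weight w
af-upper {n} {w} 0<n len legal =
  let S , S∈ , S≤F = antiForcing-from {H n} {wordMatching n f} F (word⇒perfect {n} {f} 0<n legal (cong isL (beyond n ℕ.≤-refl)))
        (λ e∈ e∈F → disjoint e∈ (∈-map⁻ edge e∈F)) (λ N∈ avoids → unique avoids (perfect⇒word {n} 0<n N∈))
  in S , S∈ , subst (length S ≤_) (trans (length-map edge (forcedWord 0 w)) (length-forcedWord 0 w)) S≤F
  where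
  f : Word
  f = at w
  F : List Edge
  F = map edge (forcedWord 0 w)
  beyond : ∀ i → n ≤ i → f i ≡ filler
  beyond i n≤i = at-beyond w (subst (_≤ i) (sym len) n≤i)
  disjoint : ∀ {e} → e ∈ wordMatching n f → ¬ (∃ λ q → q ∈ forcedWord 0 w × e ≡ edge q)
  disjoint e∈ (q , q∈ , refl) = let i , q∈i = ∈-forcedWord⁻ 0 w q∈ in
    contradiction (trans (sym (proj₂ (∈-matching⁻ {n} {select f} {q} e∈))) (All.lookup (avoids-forced f i) q∈i)) λ ()
  unique : ∀ {N} → (∀ {e} → e ∈ N → e ∉ F) → (∃ λ g → Legal g × (∀ i → n ≤ i → g i ≡ filler) × N ≡ wordMatching n g) →
           N ≡ wordMatching n f
  unique avoids (g , _ , beyond′ , refl) = wordMatching-cong n same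
    where
    av : ∀ i → i < n → Avoids g (forced (f i) i)
    av i i<n = All.tabulate λ {q} q∈ → ¬-not λ sel →
      avoids (∈-matching⁺ {n} {select g} {q} 0<n (All.lookup (forced-inBounds (f i) i<n) q∈) sel)
             (∈-map⁺ edge (∈-forcedWord⁺ 0 w (subst (i <_) (sym len) i<n) q∈))
    same : ∀ i → g i ≡ f i
    same i = go (i <? n)
      where
      go : Dec (i < n) → g i ≡ f i
      go (yes i<n) = forced-unique {n} {f} {g} legal (cong isL (beyond′ n ℕ.≤-refl)) av i i<n
      go (no i≮n)  = trans (beyond′ i (ℕ.≮⇒≥ i≮n)) (sym (beyond i (ℕ.≮⇒≥ i≮n)))

af-word : ∀ {n w} → 0 < n → w ∈ words false n → af (H n) (wordMatching n (at w)) ≡ weight w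
af-word {n} {w} 0<n w∈ = let len , _ , legal = ∈-words⁻ false n w∈ in
  af-≡ {H n} {wordMatching n (at w)} (af-lower {n} {w} 0<n len legal) (af-upper {n} {w} 0<n len legal)

-- Polynomials

coeff-+ₚ : ∀ p q k → coeff (p +ₚ q) k ≡ coeff p k ℤ.+ coeff q k
coeff-+ₚ []      q       k       = sym (ℤ.+-identityˡ (coeff q k))
coeff-+ₚ (x ∷ p) []      k       = sym (ℤ.+-identityʳ (coeff (x ∷ p) k))
coeff-+ₚ (x ∷ p) (y ∷ q) zero    = refl
coeff-+ₚ (x ∷ p) (y ∷ q) (suc k) = coeff-+ₚ p q k

coeff-· : ∀ c p k → coeff (c · p) k ≡ c ℤ.* coeff p k
coeff-· c []      k       = sym (ℤ.*-zeroʳ c)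
coeff-· c (x ∷ p) zero    = refl
coeff-· c (x ∷ p) (suc k) = coeff-· c p k

coeff-neg : ∀ p k → coeff (map ℤ.-_ p) k ≡ ℤ.- coeff p k
coeff-neg []      k       = refl
coeff-neg (x ∷ p) zero    = refl
coeff-neg (x ∷ p) (suc k) = coeff-neg p k

+ₚ-cong : ∀ {p p′ q q′} → p ≈ p′ → q ≈ q′ → p +ₚ q ≈ p′ +ₚ q′
+ₚ-cong {p} {p′} {q} {q′} p≈ q≈ k =
  trans (coeff-+ₚ p q k) (trans (cong₂ ℤ._+_ (p≈ k) (q≈ k)) (sym (coeff-+ₚ p′ q′ k)))

-ₚ-cong : ∀ {p p′ q q′} → p ≈ p′ → q ≈ q′ → p -ₚ q ≈ p′ -ₚ q′
-ₚ-cong {p} {p′} {q} {q′} p≈ q≈ = +ₚ-cong {p} {p′} p≈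
  (λ k → trans (coeff-neg q k) (trans (cong ℤ.-_ (q≈ k)) (sym (coeff-neg q′ k))))

∷-cong : ∀ {x p q} → p ≈ q → x ∷ p ≈ x ∷ q
∷-cong p≈q zero    = refl
∷-cong p≈q (suc k) = p≈q k

·-cong : ∀ c {p q} → p ≈ q → c · p ≈ c · q
·-cong c {p} {q} p≈q k = trans (coeff-· c p k) (trans (cong (c ℤ.*_) (p≈q k)) (sym (coeff-· c q k)))

*ₚ-congˡ : ∀ p {q r} → q ≈ r → p *ₚ q ≈ p *ₚ r
*ₚ-congˡ []          q≈r k = refl
*ₚ-congˡ (x ∷ p) {q} {r} q≈r = +ₚ-cong {x · q} {x · r} (·-cong x {q} {r} q≈r) (∷-cong (*ₚ-congˡ p {q} {r} q≈r))

+ₚ-swap : ∀ p q {r s} → r ≈ s → p +ₚ (q +ₚ r) ≈ q +ₚ (p +ₚ s)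
+ₚ-swap p q {r} {s} r≈s k
  rewrite coeff-+ₚ p (q +ₚ r) k | coeff-+ₚ q r k | coeff-+ₚ q (p +ₚ s) k | coeff-+ₚ p s k | r≈s k =
  solve 3 (λ x y z → x :+ (y :+ z) := y :+ (x :+ z)) refl (coeff p k) (coeff q k) (coeff s k)
  where open +-*-Solver

∑ₚ-↭ : ∀ {ps qs} → ps ↭ qs → ∑ₚ ps ≈ ∑ₚ qs
∑ₚ-↭ ↭.refl                 k = refl
∑ₚ-↭ (↭.prep {ps} {qs} p r)   = +ₚ-cong {p} {p} {∑ₚ ps} {∑ₚ qs} (λ _ → refl) (∑ₚ-↭ r)
∑ₚ-↭ (↭.swap {ps} {qs} p q r) = +ₚ-swap p q {∑ₚ ps} {∑ₚ qs} (∑ₚ-↭ r)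
∑ₚ-↭ (↭.trans r s)          k = trans (∑ₚ-↭ r k) (∑ₚ-↭ s k)

∑ₚ-++ : ∀ ps qs → ∑ₚ (ps ++ qs) ≈ ∑ₚ ps +ₚ ∑ₚ qs
∑ₚ-++ []       qs k = refl
∑ₚ-++ (p ∷ ps) qs k
  rewrite coeff-+ₚ p (∑ₚ (ps ++ qs)) k | ∑ₚ-++ ps qs k | coeff-+ₚ (∑ₚ ps) (∑ₚ qs) k
        | coeff-+ₚ (p +ₚ ∑ₚ ps) (∑ₚ qs) k | coeff-+ₚ p (∑ₚ ps) k =
  sym (ℤ.+-assoc (coeff p k) (coeff (∑ₚ ps) k) (coeff (∑ₚ qs) k))

shift : ℕ → Poly → Poly
shift zero    p = p
shift (suc j) p = 0ℤ ∷ shift j p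

shift-cong : ∀ j {p q} → p ≈ q → shift j p ≈ shift j q
shift-cong zero    p≈q = p≈q
shift-cong (suc j) p≈q = ∷-cong (shift-cong j p≈q)

shift-+ₚ : ∀ j p q → shift j (p +ₚ q) ≡ shift j p +ₚ shift j q
shift-+ₚ zero    p q = refl
shift-+ₚ (suc j) p q = cong (0ℤ ∷_) (shift-+ₚ j p q)

shift-0ₚ : ∀ j → shift j 0ₚ ≈ 0ₚ
shift-0ₚ zero    k       = refl
shift-0ₚ (suc j) zero    = refl
shift-0ₚ (suc j) (suc k) = shift-0ₚ j k

X^-+ : ∀ j m → X^ (j + m) ≡ shift j (X^ m)
X^-+ zero    m = refl
X^-+ (suc j) m = cong (0ℤ ∷_) (X^-+ j m)

wordSum : List (List Letter) → Poly
wordSum ws = ∑ₚ (map (λ w → X^ (weight w)) ws)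

wordSum-++ : ∀ us vs → wordSum (us ++ vs) ≈ wordSum us +ₚ wordSum vs
wordSum-++ us vs rewrite map-++ (λ w → X^ (weight w)) us vs = ∑ₚ-++ (map (λ w → X^ (weight w)) us) (map (λ w → X^ (weight w)) vs)

wordSum-∷ : ∀ l ws → wordSum (map (l ∷_) ws) ≈ shift (length (tags l)) (wordSum ws)
wordSum-∷ l []       k = sym (shift-0ₚ (length (tags l)) k)
wordSum-∷ l (w ∷ ws) k
  rewrite X^-+ (length (tags l)) (weight w) | shift-+ₚ (length (tags l)) (X^ (weight w)) (wordSum ws) =
  +ₚ-cong {shift j (X^ (weight w))} {shift j (X^ (weight w))} (λ _ → refl) (wordSum-∷ l ws) k
  where j = length (tags l)

wordSum-concatMap : ∀ (g : Letter → List (List Letter)) ls →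
  wordSum (concatMap (λ l → map (l ∷_) (g l)) ls) ≈ ∑ₚ (map (λ l → shift (length (tags l)) (wordSum (g l))) ls)
wordSum-concatMap g []       k = refl
wordSum-concatMap g (l ∷ ls) k = trans (wordSum-++ (map (l ∷_) (g l)) (concatMap (λ l → map (l ∷_) (g l)) ls) k)
  (+ₚ-cong {wordSum (map (l ∷_) (g l))} {shift (length (tags l)) (wordSum (g l))} (wordSum-∷ l (g l)) (wordSum-concatMap g ls) k)

wordPoly : Bool → ℕ → Poly
wordPoly r n = wordSum (words r n)

wordPoly-suc : ∀ r n → wordPoly r (suc n) ≈ ∑ₚ (map (λ l → shift (length (tags l)) (wordPoly (isR l) n)) (letters r))
wordPoly-suc r n = wordSum-concatMap (λ l → words (isR l) n) (letters r)

wordPoly-false : ∀ n → wordPoly false (suc n) ≈ shift 1 (wordPoly false n) +ₚ wordPoly true (suc n)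
wordPoly-false n k = trans (wordPoly-suc false n k)
  (+ₚ-cong {shift 1 (wordPoly false n)} {shift 1 (wordPoly false n)}
    {∑ₚ (map (λ l → shift (length (tags l)) (wordPoly (isR l) n)) (letters true))} {wordPoly true (suc n)} (λ _ → refl) (λ k → sym (wordPoly-suc true n k)) k)

fragmentPoly : Poly
fragmentPoly = (+ 2) · X^ 3 +ₚ (+ 2) · X^ 2 +ₚ (+ 2) · X^ 1

*ₚ-0∷ : ∀ p q → p *ₚ (0ℤ ∷ q) ≈ 0ℤ ∷ (p *ₚ q)
*ₚ-0∷ []      q zero    = refl
*ₚ-0∷ []      q (suc k) = refl
*ₚ-0∷ (c ∷ p) q zero    = trans (ℤ.+-identityʳ (c ℤ.* 0ℤ)) (ℤ.*-zeroʳ c)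
*ₚ-0∷ (c ∷ p) q (suc k) = +ₚ-cong {c · q} {c · q} (λ _ → refl) (*ₚ-0∷ p q) k

coeff-*ₚ : ∀ c p q k → coeff ((c ∷ p) *ₚ q) k ≡ c ℤ.* coeff q k ℤ.+ coeff (p *ₚ (0ℤ ∷ q)) k
coeff-*ₚ c p q k = trans (coeff-+ₚ (c · q) (0ℤ ∷ (p *ₚ q)) k) (cong₂ ℤ._+_ (coeff-· c q k) (sym (*ₚ-0∷ p q k)))

coeff-∑ₚ : ∀ ps k → coeff (∑ₚ ps) k ≡ foldr (λ p c → coeff p k ℤ.+ c) 0ℤ ps
coeff-∑ₚ []       k = refl
coeff-∑ₚ (p ∷ ps) k = trans (coeff-+ₚ p (∑ₚ ps) k) (cong (ℤ._+_ (coeff p k)) (coeff-∑ₚ ps k))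

coeff-fragmentPoly*ₚ : ∀ q k → coeff (fragmentPoly *ₚ q) k ≡ + 2 ℤ.* coeff (shift 1 q) k ℤ.+ (+ 2 ℤ.* coeff (shift 2 q) k ℤ.+ + 2 ℤ.* coeff (shift 3 q) k)
coeff-fragmentPoly*ₚ q k = trans (coeff-*ₚ 0ℤ (+ 2 ∷ + 2 ∷ + 2 ∷ []) q k) (trans (ℤ.+-identityˡ _)
  (trans (coeff-*ₚ (+ 2) (+ 2 ∷ + 2 ∷ []) (shift 1 q) k) (cong (ℤ._+_ (+ 2 ℤ.* coeff (shift 1 q) k))
  (trans (coeff-*ₚ (+ 2) (+ 2 ∷ []) (shift 2 q) k) (cong (ℤ._+_ (+ 2 ℤ.* coeff (shift 2 q) k))
  (trans (coeff-*ₚ (+ 2) [] (shift 3 q) k) (ℤ.+-identityʳ _)))))))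

coeff-X²*ₚ : ∀ q k → coeff (X^ 2 *ₚ q) k ≡ coeff (shift 2 q) k
coeff-X²*ₚ q k = trans (coeff-*ₚ 0ℤ (0ℤ ∷ + 1 ∷ []) q k) (trans (ℤ.+-identityˡ _)
  (trans (coeff-*ₚ 0ℤ (+ 1 ∷ []) (shift 1 q) k) (trans (ℤ.+-identityˡ _)
  (trans (coeff-*ₚ (+ 1) [] (shift 2 q) k) (trans (ℤ.+-identityʳ _) (ℤ.*-identityˡ _))))))

wordPoly-recurrence : ∀ n → wordPoly false (suc (suc n)) ≈ fragmentPoly *ₚ wordPoly false (suc n) -ₚ X^ 2 *ₚ wordPoly false n
wordPoly-recurrence n k = begin
  coeff (wordPoly false (2 + n)) k
    ≡⟨ trans (wordPoly-suc false (suc n) k) (coeff-∑ₚ (map (λ l → shift (length (tags l)) (wordPoly (isR l) (suc n))) (letters false)) k) ⟩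
  a₁ ℤ.+ (b₁ ℤ.+ (a₃ ℤ.+ (a₃ ℤ.+ (a₂ ℤ.+ (a₂ ℤ.+ 0ℤ)))))
    ≡⟨ cong (ℤ._+ (b₁ ℤ.+ (a₃ ℤ.+ (a₃ ℤ.+ (a₂ ℤ.+ (a₂ ℤ.+ 0ℤ)))))) a₁≡ ⟩
  c₂ ℤ.+ b₁ ℤ.+ (b₁ ℤ.+ (a₃ ℤ.+ (a₃ ℤ.+ (a₂ ℤ.+ (a₂ ℤ.+ 0ℤ)))))
    ≡⟨ solve 4 (λ a₂ a₃ b₁ c₂ →
         c₂ :+ b₁ :+ (b₁ :+ (a₃ :+ (a₃ :+ (a₂ :+ (a₂ :+ con 0ℤ)))))
         := con (+ 2) :* (c₂ :+ b₁) :+ (con (+ 2) :* a₂ :+ con (+ 2) :* a₃) :+ :- c₂) refl a₂ a₃ b₁ c₂ ⟩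
  + 2 ℤ.* (c₂ ℤ.+ b₁) ℤ.+ (+ 2 ℤ.* a₂ ℤ.+ + 2 ℤ.* a₃) ℤ.+ ℤ.- c₂
    ≡⟨ cong (λ x → + 2 ℤ.* x ℤ.+ (+ 2 ℤ.* a₂ ℤ.+ + 2 ℤ.* a₃) ℤ.+ ℤ.- c₂) a₁≡ ⟨
  + 2 ℤ.* a₁ ℤ.+ (+ 2 ℤ.* a₂ ℤ.+ + 2 ℤ.* a₃) ℤ.+ ℤ.- c₂
    ≡⟨ cong₂ (λ x y → x ℤ.+ ℤ.- y) (coeff-fragmentPoly*ₚ (wordPoly false (suc n)) k) (coeff-X²*ₚ (wordPoly false n) k) ⟨
  coeff (fragmentPoly *ₚ wordPoly false (suc n)) k ℤ.+ ℤ.- coeff (X^ 2 *ₚ wordPoly false n) k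
    ≡⟨ trans (coeff-+ₚ (fragmentPoly *ₚ wordPoly false (suc n)) (map ℤ.-_ (X^ 2 *ₚ wordPoly false n)) k)
             (cong (ℤ._+_ (coeff (fragmentPoly *ₚ wordPoly false (suc n)) k)) (coeff-neg (X^ 2 *ₚ wordPoly false n) k)) ⟨
  coeff (fragmentPoly *ₚ wordPoly false (suc n) -ₚ X^ 2 *ₚ wordPoly false n) k ∎
  where
  open ≡-Reasoning
  open +-*-Solver
  a₁ = coeff (shift 1 (wordPoly false (suc n))) k
  a₂ = coeff (shift 2 (wordPoly false (suc n))) k
  a₃ = coeff (shift 3 (wordPoly false (suc n))) k
  b₁ = coeff (shift 1 (wordPoly true (suc n))) k
  c₂ = coeff (shift 2 (wordPoly false n)) k
  a₁≡ : a₁ ≡ c₂ ℤ.+ b₁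
  a₁≡ = trans (∷-cong {q = shift 1 (wordPoly false n) +ₚ wordPoly true (suc n)} (wordPoly-false n) k)
              (coeff-+ₚ (shift 2 (wordPoly false n)) (shift 1 (wordPoly true (suc n))) k)

Af≈wordPoly⁺ : ∀ n → 0 < n → Af (H n) ≈ wordPoly false n
Af≈wordPoly⁺ n 0<n k = trans (∑ₚ-↭ (↭.map⁺ (λ M → X^ (af (H n) M)) (perfectMatchings↭words n 0<n)) k)
  (cong (λ ps → coeff (∑ₚ ps) k) (trans (sym (map-∘ (words false n)))
    (map-cong-local (All.tabulate λ {w} w∈ → cong X^_ (af-word {n} {w} 0<n w∈)))))

Af≈wordPoly : ∀ n → Af (H n) ≈ wordPoly false n
Af≈wordPoly zero    k = refl
Af≈wordPoly (suc n) k = Af≈wordPoly⁺ (suc n) (s≤s z≤n) k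

wordPoly-recurrence′ : ∀ n → n ≥ 2 → wordPoly false n ≈ fragmentPoly *ₚ wordPoly false (n ∸ 1) -ₚ X^ 2 *ₚ wordPoly false (n ∸ 2)
wordPoly-recurrence′ (suc (suc n)) (s≤s (s≤s z≤n)) = wordPoly-recurrence n

Af-recurrence : ∀ n → n ≥ 2 → Af (H n) ≈ fragmentPoly *ₚ Af (H (n ∸ 1)) -ₚ X^ 2 *ₚ Af (H (n ∸ 2))
Af-recurrence n n≥2 k = trans (Af≈wordPoly n k) (trans (wordPoly-recurrence′ n n≥2 k)
  (-ₚ-cong {fragmentPoly *ₚ wordPoly false (n ∸ 1)} {fragmentPoly *ₚ Af (H (n ∸ 1))} {X^ 2 *ₚ wordPoly false (n ∸ 2)} {X^ 2 *ₚ Af (H (n ∸ 2))}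
    (*ₚ-congˡ fragmentPoly {wordPoly false (n ∸ 1)} {Af (H (n ∸ 1))} (λ k → sym (Af≈wordPoly (n ∸ 1) k)))
    (*ₚ-congˡ (X^ 2) {wordPoly false (n ∸ 2)} {Af (H (n ∸ 2))} (λ k → sym (Af≈wordPoly (n ∸ 2) k))) k))

theorem4p1 : (Af (H 0) ≈ 1ₚ)
    × (Af (H 1) ≈ (+ 2) · X^ 3 +ₚ (+ 2) · X^ 2 +ₚ (+ 2) · X^ 1)
    × ((n : ℕ) → n ≥ 2 →
    Af (H n) ≈ ((+ 2) · X^ 3 +ₚ (+ 2) · X^ 2 +ₚ (+ 2) · X^ 1) *ₚ Af (H (n ∸ 1)) -ₚ X^ 2 *ₚ Af (H (n ∸ 2)))
theorem4p1 = Af≈wordPoly 0 , (λ k → Af≈wordPoly 1 k) , Af-recurrence
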